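{- For every prime $p\geq 3$ and every integer $r\geq 3$, $$g_r(\mathbb{Z}_p)= \binom{r}{2}2^p-r^2+2r+ r\binom{r-1}{2}p\Big(2^{\frac{p-1}{c \cdot \mathrm{ord}_p(2)}}-2\Big),$$ where $c=1$ if $\mathrm{ord}_p(2)$ is even, and $c=2$ otherwise.
   Context: $\mathbb{Z}_p$ is the cyclic group $\{0,1,\ldots,p-1\}$ under addition modulo $p$. A 3-AP in $\mathbb{Z}_p$ is a sequence $a,b,c$ of elements of $\mathbb{Z}_p$ with $a+c\equiv 2b \pmod p$. An $r$-coloring of $\mathbb{Z}_p$ is any map $\mathbb{Z}_p\to[r]=\{1,\dots,r\}$ (not necessarily surjective); it is rainbow 3-AP-free if there is no 3-AP in $\mathbb{Z}_p$ whose three terms have pairwise distinct colors. $g_r(\mathbb{Z}_p)$ is the number of rainbow 3-AP-free $r$-colorings of $\mathbb{Z}_p$. $\mathrm{ord}_p(2)$ is the order of $2$ in the multiplicative group $\mathbb{Z}_p^\times$ of integers modulo $p$. -}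

module Defs where

open import Data.Bool.Base using (true; false; if_then_else_)
open import Data.Fin.Base as Fin using (Fin; toℕ; fromℕ<; finToFun)
import Data.Fin.Properties as Fin
open import Data.List.Base using (List; length; filter; tabulate)
open import Data.Nat.Base
open import Data.Nat.Coprimality using (Coprime; coprime-divisor; sym)
open import Data.Nat.Divisibility
open import Data.Nat.DivMod
open import Data.Nat.Properties
open import Data.Product.Base using (∃; _×_; _,_)
open import Relation.Binary.PropositionalEquality as ≡ using (_≡_; _≢_; refl; cong; subst)
open import Relation.Nullary.Decidable using (Dec; yes; no; does; ¬?; _×-dec_; _→-dec_)
open import Relation.Nullary.Negation using (¬_; contradiction)
open import Relation.Unary using (Pred; Decidable)

infix 4 _≡_[mod_]

_≡_[mod_] : ℕ → ℕ → ℕ → Set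
a ≡ b [mod n ] = n ∣ ∣ a - b ∣

_≡?_[mod_] : ∀ a b n → Dec (a ≡ b [mod n ])
a ≡? b [mod n ] = n ∣? ∣ a - b ∣

-- The residues modulo p are the elements of Fin p.
-- Degenerate progressions (with equal terms) are included.

AP₃ : ∀ {p} → Fin p → Fin p → Fin p → Set
AP₃ {p} x y z = toℕ x + toℕ z ≡ 2 * toℕ y [mod p ]

Coloring : ℕ → ℕ → Set
Coloring r p = Fin p → Fin r

Rainbow : ∀ {r p} → Coloring r p → Fin p → Fin p → Fin p → Set
Rainbow f x y z = f x ≢ f y × f y ≢ f z × f x ≢ f z

RainbowFree : ∀ {r p} → Coloring r p → Set
RainbowFree f = ∀ x y z → AP₃ x y z → ¬ Rainbow f x y z

rainbowFree? : ∀ {r p} → Decidable (RainbowFree {r} {p})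
rainbowFree? {p = p} f = Fin.all? λ x → Fin.all? λ y → Fin.all? λ z →
  ((toℕ x + toℕ z) ≡? (2 * toℕ y) [mod p ])
  →-dec ¬? (¬? (f x Fin.≟ f y) ×-dec ¬? (f y Fin.≟ f z) ×-dec ¬? (f x Fin.≟ f z))

-- finToFun is a bijection, up to pointwise equality, from Fin (r ^ p) to
-- Fin p → Fin r, with inverse funToFin; each coloring is listed exactly once.

colorings : ∀ r p → List (Coloring r p)
colorings r p = tabulate {n = r ^ p} finToFun

g : ℕ → ℕ → ℕ
g r p = length (filter rainbowFree? (colorings r p))

record IsOrder (n a k : ℕ) : Set where
  field
    positive : 1 ≤ k
    power    : a ^ k ≡ 1 [mod n ]
    minimal  : ∀ j → 1 ≤ j → a ^ j ≡ 1 [mod n ] → k ≤ j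

-- The least k < bound satisfying P, or bound if there is none.

least : ∀ {ℓ} {P : Pred ℕ ℓ} → Decidable P → ℕ → ℕ
least P? zero        = 0
least P? (suc bound) =
  if does (P? 0) then 0 else suc (least (λ k → P? (suc k)) bound)

least-satisfies : ∀ {ℓ} {P : Pred ℕ ℓ} (P? : Decidable P) bound →
                  ∀ {k} → k < bound → P k → P (least P? bound)
least-satisfies P? (suc bound) {k} k<b Pk with P? 0
... | yes P0 = P0
least-satisfies P? (suc bound) {zero}  k<b Pk | no ¬P0 = contradiction Pk ¬P0
least-satisfies P? (suc bound) {suc k} k<b Pk | no ¬P0 =
  least-satisfies (λ i → P? (suc i)) bound (s<s⁻¹ k<b) Pk

least-minimal : ∀ {ℓ} {P : Pred ℕ ℓ} (P? : Decidable P) bound →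
                ∀ {k} → P k → least P? bound ≤ k
least-minimal P? zero        Pk = z≤n
least-minimal P? (suc bound) {k} Pk with P? 0
... | yes P0 = z≤n
least-minimal P? (suc bound) {zero}  Pk | no ¬P0 = contradiction Pk ¬P0
least-minimal P? (suc bound) {suc k} Pk | no ¬P0 =
  s≤s (least-minimal (λ i → P? (suc i)) bound Pk)

-- The least k ≥ 1 with a ^ k ≡ 1 modulo n. For a coprime to n the search
-- succeeds within its bound (ord-isOrder); otherwise the value is meaningless.

ord : ℕ → ℕ → ℕ
ord n a = suc (least (λ k → (a ^ suc k) ≡? 1 [mod n ]) n)

private
  %≡%⇒≡mod : ∀ {a b} n .{{_ : NonZero n}} → b ≤ a → a % n ≡ b % n → n ∣ a ∸ b
  %≡%⇒≡mod {a} {b} n b≤a eq = ∣m+n∣m⇒∣n (subst (n ∣_) step (n∣m*n (a / n))) (n∣m*n (b / n))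
    where
    open ≡.≡-Reasoning
    step : a / n * n ≡ b / n * n + (a ∸ b)
    step = +-cancelˡ-≡ (a % n) _ _ (begin
      a % n + a / n * n              ≡⟨ m≡m%n+[m/n]*n a n ⟨
      a                              ≡⟨ m+[n∸m]≡n b≤a ⟨
      b + (a ∸ b)                    ≡⟨ cong (_+ (a ∸ b)) (m≡m%n+[m/n]*n b n) ⟩
      b % n + b / n * n + (a ∸ b)    ≡⟨ +-assoc (b % n) _ _ ⟩
      b % n + (b / n * n + (a ∸ b))  ≡⟨ cong (_+ (b / n * n + (a ∸ b))) eq ⟨
      a % n + (b / n * n + (a ∸ b))  ∎)

  coprime-cancel-^ : ∀ {n a m} → Coprime a n → ∀ i → n ∣ a ^ i * m → n ∣ m
  coprime-cancel-^ {m = m} a⊥n zero    d = subst (_ ∣_) (*-identityˡ m) d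
  coprime-cancel-^ {n} {a} {m} a⊥n (suc i) d =
    coprime-cancel-^ a⊥n i
      (coprime-divisor (sym a⊥n) (subst (n ∣_) (*-assoc a (a ^ i) m) d))

  power≡1 : ∀ n .{{_ : NonZero n}} a .{{_ : NonZero a}} → Coprime a n →
            ∃ λ k → k < n × a ^ suc k ≡ 1 [mod n ]
  power≡1 n a a⊥n
    with i , j , i<j , eq ← Fin.pigeonhole {n} {suc n} (n<1+n n)
                              (λ i → fromℕ< (m%n<n (a ^ toℕ i) n)) =
    k , k<n , subst (n ∣_) (≡.sym (m≤n⇒∣n-m∣≡n∸m (m^n>0 a (suc k)))) n∣a^1+k∸1
    where
    k = toℕ j ∸ suc (toℕ i)

    i+1+k≡j : toℕ i + suc k ≡ toℕ j
    i+1+k≡j = ≡.trans (+-suc (toℕ i) k) (m+[n∸m]≡n i<j)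

    k<n : k < n
    k<n = ≤-trans (m≤n+m (suc k) (toℕ i))
            (subst (_≤ n) (≡.sym i+1+k≡j) (s≤s⁻¹ (Fin.toℕ<n j)))

    eq% : a ^ toℕ j % n ≡ a ^ toℕ i % n
    eq% = ≡.trans (≡.sym (Fin.toℕ-fromℕ< _))
            (≡.trans (cong toℕ (≡.sym eq)) (Fin.toℕ-fromℕ< _))

    open ≡.≡-Reasoning
    factor : a ^ toℕ j ∸ a ^ toℕ i ≡ a ^ toℕ i * (a ^ suc k ∸ 1)
    factor = begin
      a ^ toℕ j ∸ a ^ toℕ i                      ≡⟨ cong (λ e → a ^ e ∸ a ^ toℕ i) i+1+k≡j ⟨
      a ^ (toℕ i + suc k) ∸ a ^ toℕ i            ≡⟨ cong (_∸ a ^ toℕ i) (^-distribˡ-+-* a (toℕ i) (suc k)) ⟩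
      a ^ toℕ i * a ^ suc k ∸ a ^ toℕ i          ≡⟨ cong (a ^ toℕ i * a ^ suc k ∸_) (*-identityʳ (a ^ toℕ i)) ⟨
      a ^ toℕ i * a ^ suc k ∸ a ^ toℕ i * 1      ≡⟨ *-distribˡ-∸ (a ^ toℕ i) (a ^ suc k) 1 ⟨
      a ^ toℕ i * (a ^ suc k ∸ 1)                ∎

    n∣a^1+k∸1 : n ∣ a ^ suc k ∸ 1
    n∣a^1+k∸1 = coprime-cancel-^ a⊥n (toℕ i)
      (subst (n ∣_) factor (%≡%⇒≡mod n (^-monoʳ-≤ a (<⇒≤ i<j)) eq%))

ord-isOrder : ∀ n .{{_ : NonZero n}} a .{{_ : NonZero a}} →
              Coprime a n → IsOrder n a (ord n a)
ord-isOrder n a a⊥n with k , k<n , a^1+k≡1 ← power≡1 n a a⊥n = record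
  { positive = s≤s z≤n
  ; power    = least-satisfies (λ k → (a ^ suc k) ≡? 1 [mod n ]) n k<n a^1+k≡1
  ; minimal  = λ where
      (suc j) _ a^1+j≡1 → s≤s (least-minimal (λ k → (a ^ suc k) ≡? 1 [mod n ]) n a^1+j≡1)
  }

c : ℕ → ℕ
c p = if does (2 ∣? ord p 2) then 1 else 2

private
  if-nonZero : ∀ b → NonZero (if b then 1 else 2)
  if-nonZero true  = _
  if-nonZero false = _

-- For an odd prime p, c p * ord p 2 divides p - 1: the order divides p - 1, which
-- is even, so twice an odd order divides it too. Hence natural-number division
-- of p - 1 by it is exact.

c*ord-nonZero : ∀ p → NonZero (c p * ord p 2)
c*ord-nonZero p = m*n≢0 (c p) (ord p 2) {{if-nonZero (does (2 ∣? ord p 2))}}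

{-# OPTIONS --safe #-}

-- Merge the colours of a rainbow-free colouring into three, all of them used.
-- For every step d ≠ 0 one colour is dominant: it occurs in each pair x, x + d
-- of two different colours. Otherwise a progression of step d contains a stretch
-- X Y … Z X whose interior avoids X, and reflecting the interior in the end
-- points produces a rainbow 3-AP or a stretch of half the length. Comparing the
-- dominant colours of the multiples of a step shows that some colour is dominant
-- for no step, and that this colour is used exactly once.
--
-- Hence a rainbow-free colouring with at least three colours has a centre whose
-- colour is not used elsewhere. The 3-APs through the centre make the rest
-- constant on the orbits of ⟨-1, 2⟩ around it, and exactly two more colours occur.
-- Multiplication by ⟨-1, 2⟩ is free on nonzero residues and the group has
-- c p * ord p 2 elements, so there are m = (p - 1) / (c p * ord p 2) orbits and
-- the total is r + r(r-1)(2^(p-1) - 1) + p r (r-1)(r-2)(2^(m-1) - 1).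

module Submission where

open import Defs
open import Data.Bool.Base using (if_then_else_)
open import Data.Empty using (⊥; ⊥-elim)
open import Data.Fin.Base as Fin using (Fin; zero; suc; toℕ; fromℕ<)
import Data.Fin.Properties as Fin
open import Data.Integer.Base using (ℤ; +_; -[1+_]; -_; ∣_∣; _+_; _-_; _*_)
import Data.Integer.Divisibility.Signed as ℤ
open import Data.Integer.DivMod using (_%ℕ_; _/ℕ_; n%ℕd<d; a≡a%ℕn+[a/ℕn]*n)
import Data.Integer.Properties as ℤ
open import Data.Integer.Tactic.RingSolver using (solve-∀)
open import Data.List.Base using (filter; length; tabulate)
open import Data.Nat.Base as ℕ using (ℕ; zero; suc; _∸_; _^_; _/_; _≤_; _<_; s≤s; z≤n; NonZero)
open import Data.Nat.Combinatorics using (_C_; nC1≡n; nCk+nC[k+1]≡[n+1]C[k+1])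
open import Data.Nat.Coprimality as Coprime using (coprime-Bézout; prime⇒coprime)
import Data.Nat.Divisibility as ℕ
import Data.Nat.DivMod as ℕ
open import Data.Nat.GCD using (module Bézout)
open import Data.Nat.Induction using (<-rec)
open import Data.Nat.Primality using (Prime; euclidsLemma; prime⇒nonTrivial)
import Data.Nat.Properties as ℕ
open import Data.Product.Base using (∃; ∃₂; _×_; _,_; proj₁; proj₂)
open import Data.Product.Function.NonDependent.Propositional using (_×-↔_)
open import Data.Sum.Base using (_⊎_; inj₁; inj₂; [_,_]′)
open import Data.Sum.Function.Propositional using (_⊎-↔_)
open import Function.Base using (_∘_; case_of_)
open import Function.Bundles using (_↔_; Inverse)
open import Function.Construct.Composition using (_↔-∘_)
open import Function.Construct.Identity using (↔-id)
open import Function.Construct.Symmetry using (↔-sym)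
open import Function.Definitions using (Injective)
open import Relation.Binary.PropositionalEquality
  using (_≡_; _≢_; refl; sym; trans; cong; cong₂; subst; subst₂; _≗_; module ≡-Reasoning)
open import Relation.Nullary.Decidable
  using (does; Dec; yes; no; ¬?; _×-dec_; _→-dec_; _⊎-dec_; from-yes; map′; decidable-stable)
open import Relation.Nullary.Negation using (¬_; contradiction)
open import Relation.Unary using (Decidable)

-- Stretches between consecutive points of one colour

-- The length of a stretch makes sense in ℤ but not in `Fin p`, so colourings are lifted to periodic
-- colourings of ℤ and the descent takes place there. Primality enters through `reach`: every
-- nonzero step generates all residues, so a nonzero translation mapping a colour class into itself
-- makes the colouring constant. A colour B dominant for u cannot be dominant for all multiples of
-- u, since some multiple joins points of the two other colours. Where B is dominant for ku but
-- another colour Y for (k+1)u, each point of the remaining colour Z has B at both distances u and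
-- -u: Z is surrounded by B. A cycle of this relation would compose to a nonzero translation
-- preserving a class, so there is none. But every colour that is dominant for some nonzero step
-- surrounds another colour, so three such colours would force a cycle.

Distinct : ∀ {r} → Fin r → Fin r → Fin r → Set
Distinct X Y Z = X ≢ Y × Y ≢ Z × X ≢ Z

Colour : Set
Colour = Fin 3

module _ {r} {X Y Z : Fin r} where

  swap₁₂ : Distinct X Y Z → Distinct Y X Z
  swap₁₂ (X≢Y , Y≢Z , X≢Z) = X≢Y ∘ sym , X≢Z , Y≢Z

  swap₂₃ : Distinct X Y Z → Distinct X Z Y
  swap₂₃ (X≢Y , Y≢Z , X≢Z) = X≢Z , Y≢Z ∘ sym , X≢Y

  rotate : Distinct X Y Z → Distinct Y Z X
  rotate (X≢Y , Y≢Z , X≢Z) = Y≢Z , X≢Z ∘ sym , X≢Y ∘ sym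

third : ∀ {X Y Z : Colour} → Distinct X Y Z → ∀ {t} → t ≢ X → t ≢ Y → t ≡ Z
third {X} {Y} {Z} d {t} = table X Y Z t d
  where
  table : ∀ (X Y Z t : Colour) → Distinct X Y Z → t ≢ X → t ≢ Y → t ≡ Z
  table = from-yes (Fin.all? {3} λ X → Fin.all? {3} λ Y → Fin.all? {3} λ Z → Fin.all? {3} λ t →
    (¬? (X Fin.≟ Y) ×-dec ¬? (Y Fin.≟ Z) ×-dec ¬? (X Fin.≟ Z)) →-dec
    ¬? (t Fin.≟ X) →-dec ¬? (t Fin.≟ Y) →-dec (t Fin.≟ Z))

thirdColour : ∀ {X Y : Colour} → X ≢ Y → ∃ (Distinct X Y)
thirdColour {X} {Y} = table X Y
  where
  table : ∀ (X Y : Colour) → X ≢ Y → ∃ (Distinct X Y)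
  table = from-yes (Fin.all? {3} λ X → Fin.all? {3} λ Y → ¬? (X Fin.≟ Y) →-dec Fin.any? {3} λ Z →
    ¬? (X Fin.≟ Y) ×-dec ¬? (Y Fin.≟ Z) ×-dec ¬? (X Fin.≟ Z))

others : ∀ (X : Colour) → ∃₂ (Distinct X)
others zero             = suc zero , suc (suc zero) , (λ ()) , (λ ()) , λ ()
others (suc zero)       = zero , suc (suc zero) , (λ ()) , (λ ()) , λ ()
others (suc (suc zero)) = zero , suc zero , (λ ()) , (λ ()) , λ ()

-- The colours are separate variables with equations, so that a known colour is supplied as a proof
-- rather than by rewriting.
NoRainbow : ∀ {r} → (ℤ → Fin r) → Set
NoRainbow G = ∀ x y z → x + z ≡ y + y →
  ∀ {X Y Z} → G x ≡ X → G y ≡ Y → G z ≡ Z → ¬ Distinct X Y Z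

halve : ∀ n → ∃ λ m → n ≡ m ℕ.+ m ⊎ n ≡ suc (m ℕ.+ m)
halve zero    = 0 , inj₁ refl
halve (suc n) with halve n
... | m , inj₁ refl = m , inj₂ refl
... | m , inj₂ refl = suc m , inj₁ (cong suc (sym (ℕ.+-suc m m)))

-- Here `n` counts the interior points; the second end point is `suc n`.
Arc : (ℤ → Colour) → Colour → Colour → Colour → ℕ → Set
Arc G X Y Z n =
  G (+ 0) ≡ X × G (+ 1) ≡ Y × G (+ n) ≡ Z × G (+ suc n) ≡ X ×
  (∀ {i} → 0 < i → i ≤ n → G (+ i) ≢ X)

noRainbow-∘ : ∀ {r} {G : ℤ → Fin r} → NoRainbow G → ∀ s d → NoRainbow (λ x → G (s + d * x))
noRainbow-∘ {G = G} rf s d x y z e = rf _ _ _ (begin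
  s + d * x + (s + d * z)  ≡⟨ collect s d x z ⟩
  s + s + d * (x + z)      ≡⟨ cong (λ t → s + s + d * t) e ⟩
  s + s + d * (y + y)      ≡⟨ collect s d y y ⟨
  s + d * y + (s + d * y)  ∎)
  where
  open ≡-Reasoning
  collect : ∀ s d x z → s + d * x + (s + d * z) ≡ s + s + d * (x + z)
  collect = solve-∀

-- The endpoints reflect 0 < i to 2i without change of colour. If suc n is even
-- this makes x ↦ G (2x) carry a shorter arc; if it is odd, G (-1) = X is forced,
-- and then every interior point has colour Y by strong induction.
noArc : ∀ n {G : ℤ → Colour} {X Y Z} → NoRainbow G → Distinct X Y Z → ¬ Arc G X Y Z n
noArc = <-rec _ step
  where
  step : ∀ n → (∀ {m} → m < n → ∀ {G : ℤ → Colour} {X Y Z} → NoRainbow G → Distinct X Y Z → ¬ Arc G X Y Z m) →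
         ∀ {G : ℤ → Colour} {X Y Z} → NoRainbow G → Distinct X Y Z → ¬ Arc G X Y Z n
  step n rec {G} {X} {Y} {Z} rf d@(X≢Y , Y≢Z , X≢Z) (G0 , G1 , Gn , GN , G≢X) = split (halve n)
    where
    double : ∀ {i} → 0 < i → i ℕ.+ i ≤ n → G (+ (i ℕ.+ i)) ≡ G (+ i)
    double {i} 0<i 2i≤n = decidable-stable (_ Fin.≟ _) λ ne →
      rf (+ 0) (+ i) (+ (i ℕ.+ i)) refl G0 refl refl
        (G≢X 0<i (ℕ.m+n≤o⇒m≤o i 2i≤n) ∘ sym , ne ∘ sym , G≢X (ℕ.≤-trans 0<i (ℕ.m≤m+n i i)) 2i≤n ∘ sym)

    reflect : ∀ {x} i → x + + suc n ≡ + i + + i → 0 < i → i ≤ n → G x ≢ X → G x ≡ G (+ i)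
    reflect i e 0<i i≤n x≢X = decidable-stable (_ Fin.≟ _) λ ne →
      rf _ (+ i) (+ suc n) e refl refl GN (ne , G≢X 0<i i≤n , x≢X)

    split : (∃ λ m → n ≡ m ℕ.+ m ⊎ n ≡ suc (m ℕ.+ m)) → ⊥
    split (zero , inj₁ refl) = X≢Z (trans (sym G0) Gn)
    split (zero , inj₂ refl) = Y≢Z (trans (sym G1) Gn)
    -- Here `suc n` is `2(m + 2)`, so the contracted arc has `m + 1` interior points. Its last one
    -- sits at `n - 1`, the reflection of the end point `suc n` in `n`.
    split (suc m , inj₂ refl) = rec {suc m} (s≤s (s≤s (ℕ.m≤m+n m _)))
      {G = λ x → G (+ 0 + + 2 * x)} (noRainbow-∘ {G = G} rf (+ 0) (+ 2)) d
      ( at 0 G0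
      , at 1 (trans (double {1} (s≤s z≤n) (s≤s (s≤s z≤n))) G1)
      , at (suc m) (trans (reflect n (cong +_ (shift m)) (s≤s z≤n) ℕ.≤-refl
                             (G≢X (s≤s z≤n) (ℕ.n≤1+n _))) Gn)
      , at (suc (suc m)) (trans (cong (G ∘ +_) (cong (λ k → suc (suc k)) (ℕ.+-suc m (suc m)))) GN)
      , λ {i} 0<i i≤ → G≢X (ℕ.≤-trans 0<i (ℕ.m≤m+n i i))
                            (ℕ.≤-trans (ℕ.+-mono-≤ i≤ i≤) (ℕ.n≤1+n _))
                        ∘ subst (λ x → G x ≡ X) (eq2 i) )
      where
      eq2 : ∀ i → + 0 + + 2 * + i ≡ + (i ℕ.+ i)
      eq2 i = trans (lem (+ i)) refl
        where
        lem : ∀ x → + 0 + + 2 * x ≡ x + x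
        lem = solve-∀
      at : ∀ i {W} → G (+ (i ℕ.+ i)) ≡ W → G (+ 0 + + 2 * + i) ≡ W
      at i = trans (cong G (eq2 i))
      shift : ∀ m → suc m ℕ.+ suc m ℕ.+ suc (suc (suc m ℕ.+ suc m)) ≡
                    suc (suc m ℕ.+ suc m) ℕ.+ suc (suc m ℕ.+ suc m)
      shift m = ℕ.+-suc (suc m ℕ.+ suc m) _
    split (suc m , inj₁ refl) = Y≢Z (trans (sym (allY n (s≤s z≤n) ℕ.≤-refl)) Gn)
      where
      M = suc m
      GM : G (+ M) ≡ Z
      GM = trans (sym (double {M} (s≤s z≤n) ℕ.≤-refl)) Gn
      -- Colour `Y` at -1 would form a rainbow with `M` and `suc n`, colour `Z` with 0 and 1.
      G-1 : G -[1+ 0 ] ≡ X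
      G-1 = third (rotate d)
        (λ e → rf -[1+ 0 ] (+ M) (+ suc n) refl e GM GN (rotate d))
        (λ e → rf -[1+ 0 ] (+ 0) (+ 1) refl e G0 G1 (rotate (rotate d)))
      -- An even `i` has the colour of its half. An odd `i` beyond 1 is the reflection of -1 in an
      -- earlier point of colour `Y`, so it is not `Z`.
      allY : ∀ i → 0 < i → i ≤ n → G (+ i) ≡ Y
      allY = <-rec _ λ i ih 0<i i≤n → case halve i of λ where
        (zero  , inj₁ refl) → contradiction 0<i λ ()
        (zero  , inj₂ refl) → G1
        (suc j , inj₁ refl) → trans (double {suc j} (s≤s z≤n) i≤n)
          (ih (ℕ.m<m+n (suc j) (s≤s z≤n)) (s≤s z≤n) (ℕ.m+n≤o⇒m≤o (suc j) i≤n))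
        (suc j , inj₂ refl) → third (swap₂₃ d) (G≢X 0<i i≤n)
          λ e → rf -[1+ 0 ] (+ suc j) (+ i) refl G-1
                  (ih (s≤s (ℕ.m≤m+n (suc j) _)) (s≤s z≤n) (ℕ.m+n≤o⇒m≤o (suc j) (ℕ.<⇒≤ i≤n))) e d

-- Colour changes along a progression

module Edges (h : ℕ → Colour)
  (arcless : ∀ {s n X Y Z} → Distinct X Y Z → h s ≡ X → h (suc s) ≡ Y → s < n → h n ≡ Z → h (suc n) ≡ X →
             (∀ {i} → s < i → i ≤ n → h i ≢ X) → ⊥) where

  Edge : Colour → Colour → ℕ → Set
  Edge X Y k = (h k ≡ X × h (suc k) ≡ Y) ⊎ (h k ≡ Y × h (suc k) ≡ X)

  EdgeBelow : ℕ → Colour → Colour → Set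
  EdgeBelow n X Y = ∃ λ k → k < n × Edge X Y k

  flip : ∀ {n X Y} → EdgeBelow n X Y → EdgeBelow n Y X
  flip (k , k<n , inj₁ e) = k , k<n , inj₂ e
  flip (k , k<n , inj₂ e) = k , k<n , inj₁ e

  lastBefore : ∀ {Z} n {j} → j ≤ n → h j ≡ Z → h n ≢ Z →
               ∃ λ k → k < n × h k ≡ Z × (∀ {i} → k < i → i ≤ n → h i ≢ Z)
  lastBefore n j≤n hj hn with ℕ.m≤n⇒m<n∨m≡n j≤n
  lastBefore n       j≤n hj hn | inj₂ refl = contradiction hj hn
  lastBefore {Z} (suc n) j≤n hj hn | inj₁ (s≤s j≤n′) with h n Fin.≟ Z
  ... | yes hn≡Z = n , ℕ.≤-refl , hn≡Z , λ k<i i≤n → subst (λ i → h i ≢ Z) (ℕ.≤-antisym k<i i≤n) hn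
  ... | no  hn≢Z with k , k<n , hk , later ← lastBefore n j≤n′ hj hn≢Z =
    k , ℕ.m<n⇒m<1+n k<n , hk , λ {i} k<i i≤n → case ℕ.m≤n⇒m<n∨m≡n i≤n of λ where
      (inj₁ (s≤s i≤n′)) → later k<i i≤n′
      (inj₂ refl)       → hn

  -- The `Y`-`Z` edge cannot start at `n`, which has colour `X`, so `Z` occurs at or before `n`. The
  -- last such `Z` is followed by `X`, giving the edge, or by `Y`, and then the stretch from it to
  -- `suc n` is an arc with ends `Z`.
  earlierEdge : ∀ {n X Y Z} → Distinct X Y Z → EdgeBelow (suc n) Y Z → h n ≡ X → h (suc n) ≡ Z → EdgeBelow n X Z
  earlierEdge {n} {X} {Y} {Z} d@(X≢Y , Y≢Z , X≢Z) (k , s≤s k≤n , e) hn hsn = fromOccurrence (occurrence e)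
    where
    occurrence : Edge Y Z k → ∃ λ j → j ≤ n × h j ≡ Z
    occurrence (inj₂ (hk , _)) = k , k≤n , hk
    occurrence (inj₁ (hk , hsk)) with ℕ.m≤n⇒m<n∨m≡n k≤n
    ... | inj₁ k<n  = suc k , k<n , hsk
    ... | inj₂ refl = contradiction (trans (sym hn) hk) X≢Y
    fromOccurrence : (∃ λ j → j ≤ n × h j ≡ Z) → EdgeBelow n X Z
    fromOccurrence (j , j≤n , hj)
      with l , l<n , hl , later ← lastBefore n j≤n hj (X≢Z ∘ trans (sym hn)) with h (suc l) Fin.≟ X
    ... | yes hsl≡X = l , l<n , inj₂ (hl , hsl≡X)
    ... | no  hsl≢X = ⊥-elim (arcless (swap₂₃ (rotate (rotate d))) hl
            (third (swap₂₃ d) hsl≢X (later ℕ.≤-refl l<n)) l<n hn hsn later)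

  pushDown : ∀ {n X Y Z} → Distinct X Y Z → EdgeBelow (suc n) X Y → EdgeBelow (suc n) Y Z →
             EdgeBelow (suc n) X Z → EdgeBelow n X Z
  pushDown d XY YZ (k , s≤s k≤n , e) with ℕ.m≤n⇒m<n∨m≡n k≤n
  ... | inj₁ k<n = k , k<n , e
  pushDown d XY YZ (k , s≤s k≤n , inj₁ (hk , hsk)) | inj₂ refl = earlierEdge d YZ hk hsk
  pushDown d XY YZ (k , s≤s k≤n , inj₂ (hk , hsk)) | inj₂ refl =
    flip (earlierEdge (swap₂₃ (rotate (rotate d))) (flip XY) hk hsk)

  -- Infinite descent: an edge at the top position always has an earlier copy, so each of the three
  -- kinds moves below `n`, until no position is left.
  notAllEdges : ∀ n {X Y Z} → Distinct X Y Z → EdgeBelow n X Y → EdgeBelow n Y Z → EdgeBelow n X Z → ⊥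
  notAllEdges (suc n) d XY YZ XZ = notAllEdges n d
    (pushDown (swap₂₃ d) XZ (flip YZ) XY) (pushDown (swap₁₂ d) (flip XY) XZ YZ) (pushDown d XY YZ XZ)

-- Residues modulo p as integers

∣m-n∣≡∣+m-+n∣ : ∀ m n → ℕ.∣ m - n ∣ ≡ ∣ + m - + n ∣
∣m-n∣≡∣+m-+n∣ m n rewrite ℤ.m-n≡m⊖n m n with ℕ.≤-total m n
... | inj₁ m≤n = trans (ℕ.m≤n⇒∣m-n∣≡n∸m m≤n) (sym (ℤ.∣⊖∣-≤ m≤n))
... | inj₂ n≤m = trans (ℕ.m≤n⇒∣n-m∣≡n∸m n≤m) (cong ∣_∣ (sym (ℤ.⊖-≥ n≤m)))

module Residues (q : ℕ) (pr : Prime (suc q)) (3≤p : 3 ≤ suc q) where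

  p : ℕ
  p = suc q

  infix 4 _≈_ _≉_

  -- A record, so that x and y can be inferred from x ≈ y.
  record _≈_ (x y : ℤ) : Set where
    constructor congruent
    field divisible : + p ℤ.∣ x - y
  open _≈_

  _≉_ : ℤ → ℤ → Set
  x ≉ y = ¬ x ≈ y

  -- Opaque here and below, since `with` would otherwise normalise these proofs.
  opaque
    -- Modular arithmetic mostly reduces to this pattern: a difference is written as an explicit
    -- combination of known differences, and the ring solver checks the identity.
    ≈-combine : ∀ {a b x y x′ y′} k l → a ≈ b → x ≈ y → x′ - y′ ≡ k * (a - b) + l * (x - y) → x′ ≈ y′
    ≈-combine k l a≈b x≈y e = congruent (subst (+ p ℤ.∣_) (sym e)
      (ℤ.∣m∣n⇒∣m+n (ℤ.∣n⇒∣m*n k (divisible a≈b)) (ℤ.∣n⇒∣m*n l (divisible x≈y))))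

    ≈-scale : ∀ {a b x y} k → a ≈ b → x - y ≡ k * (a - b) → x ≈ y
    ≈-scale k a≈b e = congruent (subst (+ p ℤ.∣_) (sym e) (ℤ.∣n⇒∣m*n k (divisible a≈b)))

    ≈-reflexive : ∀ {x y} → x ≡ y → x ≈ y
    ≈-reflexive {x} refl = congruent (ℤ.divides (+ 0) (ℤ.+-inverseʳ x))

  ≈-refl : ∀ {x} → x ≈ x
  ≈-refl = ≈-reflexive refl

  opaque
    ≈-sym : ∀ {x y} → x ≈ y → y ≈ x
    ≈-sym {x} {y} x≈y = ≈-scale (- + 1) x≈y (lem x y)
      where lem : ∀ x y → y - x ≡ - + 1 * (x - y)
            lem = solve-∀

    ≈-trans : ∀ {x y z} → x ≈ y → y ≈ z → x ≈ z
    ≈-trans {x} {y} {z} x≈y y≈z = ≈-combine (+ 1) (+ 1) x≈y y≈z (lem x y z)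
      where lem : ∀ x y z → x - z ≡ + 1 * (x - y) + + 1 * (y - z)
            lem = solve-∀

    +-cong : ∀ {x y x′ y′} → x ≈ y → x′ ≈ y′ → x + x′ ≈ y + y′
    +-cong {x} {y} {x′} {y′} x≈y x′≈y′ = ≈-combine (+ 1) (+ 1) x≈y x′≈y′ (lem x y x′ y′)
      where lem : ∀ x y x′ y′ → x + x′ - (y + y′) ≡ + 1 * (x - y) + + 1 * (x′ - y′)
            lem = solve-∀

    neg-cong : ∀ {x y} → x ≈ y → - x ≈ - y
    neg-cong {x} {y} x≈y = ≈-scale (- + 1) x≈y (lem x y)
      where lem : ∀ x y → - x - - y ≡ - + 1 * (x - y)
            lem = solve-∀

    *-cong : ∀ {x y x′ y′} → x ≈ y → x′ ≈ y′ → x * x′ ≈ y * y′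
    *-cong {x} {y} {x′} {y′} x≈y x′≈y′ = ≈-combine x′ y x≈y x′≈y′ (lem x y x′ y′)
      where lem : ∀ x y x′ y′ → x * x′ - y * y′ ≡ x′ * (x - y) + y * (x′ - y′)
            lem = solve-∀

  ≈⇒∣ : ∀ {x y} → x ≈ y → p ℕ.∣ ∣ x - y ∣
  ≈⇒∣ = ℤ.∣⇒∣ᵤ ∘ divisible

  opaque
    *≈0 : ∀ x y → x * y ≈ + 0 → x ≈ + 0 ⊎ y ≈ + 0
    *≈0 x y xy≈0 = [ inj₁ ∘ back x , inj₂ ∘ back y ]′
      (euclidsLemma ∣ x ∣ ∣ y ∣ pr (subst (p ℕ.∣_) (trans (cong ∣_∣ (ℤ.+-identityʳ (x * y))) (ℤ.abs-* x y)) (≈⇒∣ xy≈0)))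
      where
      back : ∀ x → p ℕ.∣ ∣ x ∣ → x ≈ + 0
      back x p∣x = congruent (ℤ.∣ᵤ⇒∣ (subst (λ z → p ℕ.∣ ∣ z ∣) (sym (ℤ.+-identityʳ x)) p∣x))

    *-cancelʳ : ∀ x y {z} → z ≉ + 0 → x * z ≈ y * z → x ≈ y
    *-cancelʳ x y {z} z≉0 xz≈yz with *≈0 (x - y) z (≈-scale (+ 1) xz≈yz (lem x y z))
      where lem : ∀ x y z → (x - y) * z - + 0 ≡ + 1 * (x * z - y * z)
            lem = solve-∀
    ... | inj₁ x-y≈0 = ≈-scale (+ 1) x-y≈0 (lem x y)
      where lem : ∀ x y → x - y ≡ + 1 * (x - y - + 0)
            lem = solve-∀
    ... | inj₂ z≈0 = contradiction z≈0 z≉0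

    ≈⇒≡ : ∀ {m n} → m < p → n < p → + m ≈ + n → m ≡ n
    ≈⇒≡ {m} {n} m<p n<p m≈n = ℕ.∣m-n∣≡0⇒m≡n
      (small (ℕ.≤-<-trans (ℕ.∣m-n∣≤m⊔n m n) (ℕ.⊔-lub m<p n<p))
             (subst (p ℕ.∣_) (sym (∣m-n∣≡∣+m-+n∣ m n)) (≈⇒∣ m≈n)))
      where
      small : ∀ {k} → k < p → p ℕ.∣ k → k ≡ 0
      small {zero}  k<p p∣k = refl
      small {suc k} k<p p∣k = contradiction p∣k (ℕ.>⇒∤ k<p)

  ⟦_⟧ : Fin p → ℤ
  ⟦ i ⟧ = + toℕ i

  opaque
    residue : ℤ → Fin p
    residue x = fromℕ< (n%ℕd<d x p)

    ⟦residue⟧ : ∀ x → ⟦ residue x ⟧ ≈ x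
    ⟦residue⟧ x = ≈-sym (congruent (ℤ.divides (x /ℕ p) (trans
      (cong₂ _-_ (a≡a%ℕn+[a/ℕn]*n x p) (cong +_ (Fin.toℕ-fromℕ< (n%ℕd<d x p)))) (lem (+ (x %ℕ p)) _))))
      where lem : ∀ x y → x + y - x ≡ y
            lem = solve-∀

  ⟦⟧-injective : ∀ {i j} → ⟦ i ⟧ ≈ ⟦ j ⟧ → i ≡ j
  ⟦⟧-injective {i} {j} e = Fin.toℕ-injective (≈⇒≡ (Fin.toℕ<n i) (Fin.toℕ<n j) e)

  residue-cong : ∀ {x y} → x ≈ y → residue x ≡ residue y
  residue-cong {x} {y} x≈y = ⟦⟧-injective (≈-trans (⟦residue⟧ x) (≈-trans x≈y (≈-sym (⟦residue⟧ y))))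

  residue-⟦⟧ : ∀ i → residue ⟦ i ⟧ ≡ i
  residue-⟦⟧ i = ⟦⟧-injective (⟦residue⟧ ⟦ i ⟧)

  _≈?_ : ∀ x y → Dec (x ≈ y)
  x ≈? y = map′ congruent divisible (+ p ℤ.∣? (x - y))

  opaque
    inverse : ∀ {u} → u ≉ + 0 → ∃ λ v → v * u ≈ + 1
    inverse {u} u≉0 with residue u in eq
    ... | zero  = contradiction (≈-trans (≈-sym (⟦residue⟧ u)) (≈-reflexive (cong ⟦_⟧ eq))) u≉0
    ... | suc i = fromBézout (coprime-Bézout (prime⇒coprime pr (Fin.toℕ<n (suc i))))
      where
      r : ℕ
      r = suc (toℕ i)
      u≈r : u ≈ + r
      u≈r = ≈-trans (≈-sym (⟦residue⟧ u)) (≈-reflexive (cong ⟦_⟧ eq))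
      fromBézout : Bézout.Identity 1 p r → ∃ λ v → v * u ≈ + 1
      fromBézout (Bézout.+- x y e) = - + y , ≈-trans (*-cong (≈-refl {x = - + y}) u≈r)
        (≈-sym (congruent (ℤ.divides (+ x) (trans (trans (lem (+ y) (+ r)) (cong (λ t → + 1 + t) (sym (ℤ.pos-* y r))))
          (trans (cong +_ e) (ℤ.pos-* x p))))))
        where lem : ∀ y r → + 1 - - y * r ≡ + 1 + y * r
              lem = solve-∀
      fromBézout (Bézout.-+ x y e) = + y , ≈-trans (*-cong (≈-refl {x = + y}) u≈r)
        (congruent (ℤ.divides (+ x) (trans
          (cong (λ t → t - + 1) (trans (sym (ℤ.pos-* y r)) (trans (cong +_ (sym e)) (cong (λ t → + 1 + t) (ℤ.pos-* x p)))))
          (lem (+ x * + p)))))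
        where lem : ∀ z → + 1 + z - + 1 ≡ z
              lem = solve-∀

    -- Multiply the difference by an inverse of `u`. The multiplier is a natural number so that it
    -- can drive inductions along the progression.
    reach : ∀ {u} → u ≉ + 0 → ∀ x y → ∃ λ n → y ≈ x + + n * u
    reach {u} u≉0 x y with v , vu≈1 ← inverse u≉0 = toℕ (residue ((y - x) * v)) ,
      ≈-combine (- u) (- (y - x)) (⟦residue⟧ ((y - x) * v)) vu≈1 (lem ⟦ residue ((y - x) * v) ⟧ x y u v)
      where lem : ∀ n x y u v → y - (x + n * u) ≡ - u * (n - (y - x) * v) + - (y - x) * (v * u - + 1)
            lem = solve-∀

    1≉0 : + 1 ≉ + 0
    1≉0 e = contradiction (ℕ.∣1⇒≡1 (≈⇒∣ e)) (ℕ.nonTrivial⇒≢1 {{prime⇒nonTrivial pr}})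

    2≉0 : + 2 ≉ + 0
    2≉0 e = ℕ.<⇒≱ 3≤p (ℕ.∣⇒≤ (≈⇒∣ e))

    double≈0 : ∀ x → x + x ≈ + 0 → x ≈ + 0
    double≈0 x e with *≈0 (+ 2) x (≈-trans (≈-reflexive (lem x)) e)
      where lem : ∀ x → + 2 * x ≡ x + x
            lem = solve-∀
    ... | inj₁ 2≈0 = contradiction 2≈0 2≉0
    ... | inj₂ x≈0 = x≈0

-- Dominant colours

module ThreeColours (q : ℕ) (pr : Prime (suc q)) (3≤p : 3 ≤ suc q)
  (G : ℤ → Colour) (periodic : ∀ {x y} → Residues._≈_ q pr 3≤p x y → G x ≡ G y)
  (rf : NoRainbow G) (surj : ∀ X → ∃ λ x → G x ≡ X) where

  open Residues q pr 3≤p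

  DominantAt : ℤ → Colour → ℤ → Set
  DominantAt d X x = G x ≢ X → G (x + d) ≢ X → G x ≡ G (x + d)

  Dominant : ℤ → Colour → Set
  Dominant d X = ∀ x → DominantAt d X x

  across : ∀ {d X x y} → Dominant d X → x + d ≡ y → G x ≢ X → G y ≢ X → G x ≡ G y
  across dom refl = dom _

  dominantAt? : ∀ d X x → Dec (DominantAt d X x)
  dominantAt? d X x = ¬? (G x Fin.≟ X) →-dec ¬? (G (x + d) Fin.≟ X) →-dec (G x Fin.≟ G (x + d))

  -- Periodicity leaves finitely many points to check, so dominance is decidable and its failure has
  -- a witness.
  fromResidues : ∀ {d X} → (∀ i → DominantAt d X ⟦ i ⟧) → Dominant d X
  fromResidues {d} all x x≢X x+d≢X = trans (sym here) (trans
    (all (residue x) (x≢X ∘ trans (sym here)) (x+d≢X ∘ trans (sym there))) there)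
    where
    here : G ⟦ residue x ⟧ ≡ G x
    here = periodic (⟦residue⟧ x)
    there : G (⟦ residue x ⟧ + d) ≡ G (x + d)
    there = periodic (+-cong (⟦residue⟧ x) ≈-refl)

  opaque
    dominant? : ∀ d X → Dec (Dominant d X)
    dominant? d X = map′ fromResidues (λ dom i → dom ⟦ i ⟧) (Fin.all? λ i → dominantAt? d X ⟦ i ⟧)

  Edge : ℤ → Colour → Colour → Set
  Edge d Y Z = ∃ λ x → (G x ≡ Y × G (x + d) ≡ Z) ⊎ (G x ≡ Z × G (x + d) ≡ Y)

  ¬dominant⇒edge : ∀ {d X Y Z} → Distinct X Y Z → ¬ Dominant d X → Edge d Y Z
  ¬dominant⇒edge {d} {X} {Y} {Z} dist ¬dom
    with i , ¬P ← Fin.¬∀⟶∃¬ p (DominantAt d X ∘ ⟦_⟧) (dominantAt? d X ∘ ⟦_⟧) (¬dom ∘ fromResidues)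
    with G ⟦ i ⟧ Fin.≟ Y
  ... | yes x≡Y = ⟦ i ⟧ , inj₁ (x≡Y ,
    third dist (λ e → ¬P λ _ n → contradiction e n) (λ e → ¬P λ _ _ → trans x≡Y (sym e)))
  ... | no  x≢Y = ⟦ i ⟧ , inj₂ (x≡Z ,
    third (swap₂₃ dist) (λ e → ¬P λ _ n → contradiction e n) (λ e → ¬P λ _ _ → trans x≡Z (sym e)))
    where
    x≡Z : G ⟦ i ⟧ ≡ Z
    x≡Z = third dist (λ e → ¬P λ n _ → contradiction e n) x≢Y

  opaque
    -- Without a dominant colour, each pair of colours is adjacent somewhere at distance `d`. As `d`
    -- generates the residues, all three adjacencies appear on the single progression `h`, against
    -- `notAllEdges`.
    dominant : ∀ {d} → d ≉ + 0 → ∃ (Dominant d)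
    dominant {d} d≉0 with dominant? d zero | dominant? d (suc zero) | dominant? d (suc (suc zero))
    ... | yes dom | _ | _ = _ , dom
    ... | no _ | yes dom | _ = _ , dom
    ... | no _ | no _ | yes dom = _ , dom
    ... | no ¬0 | no ¬1 | no ¬2 = ⊥-elim (impossible
            (index (¬dominant⇒edge 201-distinct ¬2)) (index (¬dominant⇒edge 012-distinct ¬0)) (index (¬dominant⇒edge 102-distinct ¬1)))
      where
      012-distinct : Distinct {3} zero (suc zero) (suc (suc zero))
      012-distinct = (λ ()) , (λ ()) , λ ()
      201-distinct : Distinct {3} (suc (suc zero)) zero (suc zero)
      201-distinct = rotate (rotate 012-distinct)
      102-distinct : Distinct {3} (suc zero) zero (suc (suc zero))
      102-distinct = swap₁₂ 012-distinct

      along : ∀ s i → d * + s + d * + i ≡ d * + (s ℕ.+ i)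
      along s i = sym (ℤ.*-distribˡ-+ d (+ s) (+ i))

      h : ℕ → Colour
      h k = G (d * + k)

      h-arcless : ∀ {s n X Y Z} → Distinct X Y Z → h s ≡ X → h (suc s) ≡ Y → s < n → h n ≡ Z → h (suc n) ≡ X →
                  (∀ {i} → s < i → i ≤ n → h i ≢ X) → ⊥
      h-arcless {s} {n} dist hs hs′ s<n hn hn′ later =
        noArc l {G = λ x → G (d * + s + d * x)} (noRainbow-∘ {G = G} rf (d * + s) d) dist
          ( at 0 (ℕ.+-identityʳ s) hs
          , at 1 (ℕ.+-comm s 1) hs′
          , at l s+l≡n hn
          , at (suc l) (trans (ℕ.+-suc s l) (cong suc s+l≡n)) hn′
          , λ {i} 0<i i≤l → later (ℕ.m<m+n s 0<i) (ℕ.≤-trans (ℕ.+-monoʳ-≤ s i≤l) (ℕ.≤-reflexive s+l≡n))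
                             ∘ trans (sym (cong G (along s i))) )
        where
        l : ℕ
        l = n ∸ s
        s+l≡n : s ℕ.+ l ≡ n
        s+l≡n = ℕ.m+[n∸m]≡n (ℕ.<⇒≤ s<n)
        at : ∀ i {k W} → s ℕ.+ i ≡ k → h k ≡ W → G (d * + s + d * + i) ≡ W
        at i s+i≡k = trans (cong G (trans (along s i) (cong (λ t → d * + t) s+i≡k)))

      open Edges h h-arcless using (notAllEdges) renaming (Edge to EdgeAt)

      index : ∀ {X Y} → Edge d X Y → ∃ (EdgeAt X Y)
      index {X} {Y} (x , e) with k , x≈kd ← reach d≉0 (+ 0) x = k , rename e
        where
        here : G (d * + k) ≡ G x
        here = periodic (≈-scale (- + 1) x≈kd (lem d (+ k) x))
          where lem : ∀ d k x → d * k - x ≡ - + 1 * (x - (+ 0 + k * d))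
                lem = solve-∀
        next : G (d * + suc k) ≡ G (x + d)
        next = periodic (≈-scale (- + 1) x≈kd (lem d (+ k) x))
          where lem : ∀ d k x → d * (+ 1 + k) - (x + d) ≡ - + 1 * (x - (+ 0 + k * d))
                lem = solve-∀
        rename : (G x ≡ X × G (x + d) ≡ Y) ⊎ (G x ≡ Y × G (x + d) ≡ X) → EdgeAt X Y k
        rename (inj₁ (a , b)) = inj₁ (trans here a , trans next b)
        rename (inj₂ (a , b)) = inj₂ (trans here a , trans next b)

      impossible : ∃ (EdgeAt zero (suc zero)) → ∃ (EdgeAt (suc zero) (suc (suc zero))) →
                   ∃ (EdgeAt zero (suc (suc zero))) → ⊥
      impossible (i , ei) (j , ej) (k , ek) = notAllEdges (suc (i ℕ.+ (j ℕ.+ k))) 012-distinct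
        (i , s≤s (ℕ.m≤m+n i _) , ei)
        (j , s≤s (ℕ.≤-trans (ℕ.m≤m+n j k) (ℕ.m≤n+m _ i)) , ej)
        (k , s≤s (ℕ.≤-trans (ℕ.m≤n+m k j) (ℕ.m≤n+m _ i)) , ek)

  -- Colours surrounded by other colours

  infix 4 _∼[_]∼_

  _∼[_]∼_ : Colour → ℤ → Colour → Set
  Z ∼[ u ]∼ X = ∀ x → G x ≡ Z → G (x + u) ≡ X × G (x - u) ≡ X

  -- Along steps of u + v each run of C ends at a point of colour A. The claim
  -- holds at the last point of the run and propagates backwards.
  opaque
    flanked : ∀ {u v A B C} → Distinct A B C → u + v ≉ + 0 →
              Dominant u B → Dominant v B → Dominant (u + v) A → C ∼[ u ]∼ B
    flanked {u} {v} {A} {B} {C} (A≢B , B≢C , A≢C) w≉0 Du Dv Dw x Gx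
      with y , Gy ← surj A with n , y≈ ← reach w≉0 x y =
      run n x Gx (λ e → A≢C (trans (sym Gy) (trans (periodic y≈) e)))
      where
      w : ℤ
      w = u + v
      is-B : ∀ {x} → ¬ (G x ≢ B) → G x ≡ B
      is-B = decidable-stable (_ Fin.≟ _)
      ≢C : ∀ {x} → G x ≡ C → G x ≢ B
      ≢C e e′ = B≢C (trans (sym e′) e)
      ≢A : ∀ {x} → G x ≡ A → G x ≢ B
      ≢A e e′ = A≢B (trans (sym e) e′)
      C≢A : ∀ {x} → G x ≡ C → G x ≢ A
      C≢A e e′ = A≢C (trans (sym e′) e)
      B≢A : ∀ {x} → G x ≡ B → G x ≢ A
      B≢A e e′ = A≢B (trans (sym e′) e)
      comm : ∀ x u v → x + v + u ≡ x + (u + v)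
      comm = solve-∀
      back : ∀ x u → x - u + u ≡ x
      back = solve-∀
      back+ : ∀ x u v → x - u + (u + v) ≡ x + v
      back+ = solve-∀
      ahead : ∀ x u v → x + u + (u + v) ≡ x + (u + v) + u
      ahead = solve-∀
      unshift : ∀ x u v → x + (u + v) - u ≡ x + v
      unshift = solve-∀
      peel : ∀ x w n → x + (+ 1 + n) * w ≡ x + w + n * w
      peel = solve-∀

      -- Otherwise `x - u` has colour `C`, and `x - u`, `x + v` is a pair of colours `C`, `B` with
      -- step `w` that misses the dominant `A`.
      left : ∀ x → G x ≡ C → G (x + v) ≡ B → G (x - u) ≡ B
      left x Gx Gxv = is-B λ n →
        let x-u≡C = trans (across Du (back x u) n (≢C Gx)) Gx in
        B≢C (trans (sym Gxv) (trans (sym (across Dw (back+ x u v) (C≢A x-u≡C) (B≢A Gxv))) x-u≡C))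

      run : ∀ n x → G x ≡ C → G (x + + n * w) ≢ C → G (x + u) ≡ B × G (x - u) ≡ B
      run zero    x Gx end = contradiction (trans (cong G (lem x w)) Gx) end
        where lem : ∀ x w → x + + 0 * w ≡ x
              lem = solve-∀
      run (suc n) x Gx end with G (x + w) Fin.≟ C
      ... | yes Gxw
        with right , inner ← run n (x + w) Gxw (end ∘ trans (cong G (peel x w (+ n))))
        = is-B (λ n → let xu≡C = trans (sym (across Du refl (≢C Gx) n)) Gx in
            B≢C (trans (sym right) (trans (sym (across Dw (ahead x u v) (C≢A xu≡C) (B≢A right))) xu≡C)))
        , left x Gx (trans (cong G (sym (unshift x u v))) inner)
      -- The run ends, so `x + w` has colour `A`. If `x + u` or `x + v`, which lie between `x` and
      -- `x + w`, were not `B`, it would share the colours `C` and `A` of both.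
      ... | no Gxw≢C =
          is-B (λ n → C≢A Gx (trans (across Du refl (≢C Gx) n) (trans (across Dv (ℤ.+-assoc x u v) n (≢A Gxw)) Gxw)))
        , left x Gx (is-B λ n →
            C≢A Gx (trans (across Dv refl (≢C Gx) n) (trans (across Du (comm x u v) n (≢A Gxw)) Gxw)))
        where
        Gxw : G (x + w) ≡ A
        Gxw = decidable-stable (_ Fin.≟ _) λ n → Gxw≢C (trans (sym (across Dw refl (C≢A Gx) n)) Gx)

  Dominates : Colour → Set
  Dominates X = ∃ λ u → u ≉ + 0 × Dominant u X

  opaque
    surround : ∀ {u B} → u ≉ + 0 → Dominant u B → ∃₂ λ Y Z → Distinct B Y Z × Dominates Y × Z ∼[ u ]∼ B
    surround {u} {B} u≉0 Du = fromSwitch (switch (proj₁ ends) (proj₂ ends))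
      where
      ends : ∃ λ n → ¬ Dominant (+ n * u) B
      ends with Y , Z , B≢Y , Y≢Z , B≢Z ← others B
        with x , Gx ← surj Y with y , Gy ← surj Z with n , y≈ ← reach u≉0 x y =
        n , λ dom → Y≢Z (trans (sym Gx) (trans (dom x (λ e → B≢Y (trans (sym e) Gx))
                      (λ e → B≢Z (trans (sym e) (trans (periodic (≈-sym y≈)) Gy))))
                      (trans (periodic (≈-sym y≈)) Gy)))

      ≈0⇒dominant : ∀ {w} → w ≈ + 0 → Dominant w B
      ≈0⇒dominant {w} w≈0 x _ _ = periodic (≈-scale (- + 1) w≈0 (lem x w))
        where lem : ∀ x w → x - (x + w) ≡ - + 1 * (w - + 0)
              lem = solve-∀

      -- The search descends from a failing multiple towards 0, where dominance is trivial.
      switch : ∀ n → ¬ Dominant (+ n * u) B → ∃ λ k → Dominant (+ k * u) B × ¬ Dominant (+ suc k * u) B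
      switch zero    ¬dom = contradiction (≈0⇒dominant ≈-refl) ¬dom
      switch (suc n) ¬dom with dominant? (+ n * u) B
      ... | yes dom = n , dom , ¬dom
      ... | no ¬dom′ = switch n ¬dom′

      fromSwitch : (∃ λ k → Dominant (+ k * u) B × ¬ Dominant (+ suc k * u) B) →
                   ∃₂ λ Y Z → Distinct B Y Z × Dominates Y × Z ∼[ u ]∼ B
      fromSwitch (k , Dv , ¬Dw) = Y , Z , dist , (u + + k * u , w≉0 , Dw) , flanked (swap₁₂ dist) w≉0 Du Dv Dw
        where
        ¬Dw′ : ¬ Dominant (u + + k * u) B
        ¬Dw′ = ¬Dw ∘ subst (λ w → Dominant w B) (lem u (+ k))
          where lem : ∀ u k → u + k * u ≡ (+ 1 + k) * u
                lem = solve-∀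
        w≉0 : u + + k * u ≉ + 0
        w≉0 = ¬Dw′ ∘ ≈0⇒dominant
        Y : Colour
        Y = proj₁ (dominant w≉0)
        Dw : Dominant (u + + k * u) Y
        Dw = proj₂ (dominant w≉0)
        B≢Y : B ≢ Y
        B≢Y e = ¬Dw′ (subst (Dominant _) (sym e) Dw)
        Z : Colour
        Z = proj₁ (thirdColour B≢Y)
        dist : Distinct B Y Z
        dist = proj₂ (thirdColour B≢Y)

  Surrounded : Colour → Colour → Set
  Surrounded Z X = ∃ λ u → u ≉ + 0 × Z ∼[ u ]∼ X

  noLoop : ∀ {X s} → s ≉ + 0 → ¬ (∀ x → G x ≡ X → G (x + s) ≡ X)
  noLoop {X} {s} s≉0 loop with Y , _ , X≢Y , _ ← others X
    with x , Gx ← surj X with y , Gy ← surj Y with n , y≈ ← reach s≉0 x y =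
    X≢Y (trans (sym (iterate n x Gx)) (trans (periodic (≈-sym y≈)) Gy))
    where
    iterate : ∀ n x → G x ≡ X → G (x + + n * s) ≡ X
    iterate zero    x Gx = trans (cong G (lem x s)) Gx
      where lem : ∀ x w → x + + 0 * w ≡ x
            lem = solve-∀
    iterate (suc n) x Gx = trans (cong G (lem x s (+ n))) (iterate n (x + s) (loop x Gx))
      where lem : ∀ x w n → x + (+ 1 + n) * w ≡ x + w + n * w
            lem = solve-∀

  -- s + w and s - w are not both 0, so the signs can be chosen to give noLoop.
  noCycle : ∀ {X Z s} → (∀ x → G x ≡ X → G (x + s) ≡ Z) → Surrounded Z X → ⊥
  noCycle {X} {Z} {s} forth (w , w≉0 , back) with (s + w) ≈? (+ 0)
  ... | no s+w≉0 = noLoop s+w≉0 λ x Gx → trans (cong G (sym (ℤ.+-assoc x s w))) (proj₁ (back _ (forth x Gx)))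
  ... | yes s+w≈0 = noLoop {s = s - w}
          (λ s-w≈0 → w≉0 (double≈0 w (≈-combine (+ 1) (- + 1) s+w≈0 s-w≈0 (lem s w))))
          λ x Gx → trans (cong G (sym (ℤ.+-assoc x s (- w)))) (proj₂ (back _ (forth x Gx)))
    where lem : ∀ s w → w + w - + 0 ≡ + 1 * (s + w - + 0) + - + 1 * (s - w - + 0)
          lem = solve-∀

  noCycle₂ : ∀ {X Z} → Surrounded X Z → Surrounded Z X → ⊥
  noCycle₂ (u , _ , XZ) = noCycle (λ x Gx → proj₁ (XZ x Gx))

  noCycle₃ : ∀ {X Y Z} → Surrounded X Y → Surrounded Y Z → Surrounded Z X → ⊥
  noCycle₃ (u , _ , XY) (v , _ , YZ) = noCycle {s = u + v} λ x Gx →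
    trans (cong G (sym (ℤ.+-assoc x u v))) (proj₁ (YZ _ (proj₁ (XY x Gx))))

  opaque
    surroundedByDominating : ∀ {X Y Z} → Distinct X Y Z → Dominates X → Surrounded Y X ⊎ Surrounded Z X
    surroundedByDominating {Y = Y} dist (u , u≉0 , Du) with surround u≉0 Du
    ... | _ , W , (_ , _ , X≢W) , _ , WX with W Fin.≟ Y
    ...   | yes refl = inj₁ (u , u≉0 , WX)
    ...   | no  W≢Y with refl ← third dist (X≢W ∘ sym) W≢Y = inj₂ (u , u≉0 , WX)

  -- A dominating colour surrounds one of the other two. Given that `X` surrounds `Z`, every choice
  -- for `Y` and `Z` closes a cycle of length two or three.
  incompatible : ∀ {X Y Z} → Distinct X Y Z → Surrounded Z X → Dominates Y → Dominates Z → ⊥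
  incompatible dist ZX DY DZ
    with surroundedByDominating (rotate dist) DY | surroundedByDominating (rotate (rotate dist)) DZ
  ... | _       | inj₁ XZ = noCycle₂ XZ ZX
  ... | inj₁ ZY | inj₂ YZ = noCycle₂ ZY YZ
  ... | inj₂ XY | inj₂ YZ = noCycle₃ XY YZ ZX

  singletonClass : ∃ λ x → ∀ y → G y ≡ G x → y ≈ x
  singletonClass
    with B , D1 ← dominant 1≉0
    with A , C , dist , DA , CB ← surround 1≉0 D1 with x , Gx ← surj C =
    x , λ y Gy → decidable-stable (y ≈? x) λ y≉x → unique y (trans Gy Gx) (y≉x ∘ difference)
    where
    difference : ∀ {x y} → y - x ≈ + 0 → y ≈ x
    difference {x} {y} e = ≈-scale (+ 1) e (lem x y)
      where lem : ∀ x y → y - x ≡ + 1 * (y - x - + 0)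
            lem = solve-∀

    -- The colour surrounded at step `y - x` is not `C`, because `x` and `y` share it. Then `C` is
    -- one of the two dominating colours, although `B` surrounds it and `A` dominates too.
    unique : ∀ y → G y ≡ C → y - x ≉ + 0 → ⊥
    unique y Gy u≉0
      with X , Du ← dominant u≉0
      with Y , Z , (X≢Y , Y≢Z , X≢Z) , DY , ZX ← surround u≉0 Du
      with Z Fin.≟ C
    ... | yes refl = X≢Z (trans (sym (proj₁ (ZX x Gx))) (trans (cong G (lem x y)) Gy))
      where lem : ∀ x y → x + (y - x) ≡ y
            lem = solve-∀
    ... | no Z≢C with X Fin.≟ C | Y Fin.≟ C
    ... | yes refl | _ = incompatible dist (_ , 1≉0 , CB) DA (_ , u≉0 , Du)
    ... | _ | yes refl = incompatible dist (_ , 1≉0 , CB) DA DY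
    ... | no X≢C | no Y≢C = Z≢C (sym (third (X≢Y , Y≢Z , X≢Z) (X≢C ∘ sym) (Y≢C ∘ sym)))

-- Orbits of ⟨-1, 2⟩

record Quotient {n} (_~_ : Fin n → Fin n → Set) : Set where
  field
    size       : ℕ
    class      : Fin n → Fin size
    rep        : Fin size → Fin n
    class-rep  : ∀ i → class (rep i) ≡ i
    rep-class  : ∀ x → x ~ rep (class x)
    class-cong : ∀ {x y} → x ~ y → class x ≡ class y

-- Elements are added one at a time: the new one joins the class of a related representative or
-- opens its own class.
quotient : ∀ {n} {_~_ : Fin n → Fin n → Set} → (∀ x → x ~ x) → (∀ {x y} → x ~ y → y ~ x) →
           (∀ {x y z} → x ~ y → y ~ z → x ~ z) → (∀ x y → Dec (x ~ y)) → Quotient _~_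
quotient {zero} _ _ _ _ = record
  { size = 0 ; class = λ () ; rep = λ () ; class-rep = λ () ; rep-class = λ () ; class-cong = λ {} }
quotient {suc n} {_~_} ~-refl ~-sym ~-trans _~?_ = extend (Fin.any? λ i → zero ~? suc (T.rep i))
  where
  tail : Quotient (λ x y → suc x ~ suc y)
  tail = quotient {n} (~-refl ∘ suc) ~-sym ~-trans (λ x y → suc x ~? suc y)
  module T = Quotient tail

  extend : Dec (∃ λ i → zero ~ suc (T.rep i)) → Quotient _~_
  extend (yes (i , zero~i)) = record
    { size = T.size ; class = cls ; rep = suc ∘ T.rep ; class-rep = T.class-rep
    ; rep-class = λ { zero → zero~i ; (suc x) → T.rep-class x } ; class-cong = λ {x} {y} → cls-cong x y }
    where
    cls : Fin (suc n) → Fin T.size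
    cls zero    = i
    cls (suc x) = T.class x
    zero-cong : ∀ {y} → zero ~ suc y → i ≡ T.class y
    zero-cong zero~y = trans (sym (T.class-rep i)) (T.class-cong (~-trans (~-sym zero~i) zero~y))
    cls-cong : ∀ x y → x ~ y → cls x ≡ cls y
    cls-cong zero    zero    _   = refl
    cls-cong zero    (suc y) x~y = zero-cong x~y
    cls-cong (suc x) zero    x~y = sym (zero-cong (~-sym x~y))
    cls-cong (suc x) (suc y) x~y = T.class-cong x~y
  extend (no ¬zero~) = record
    { size = suc T.size ; class = cls ; rep = rep
    ; class-rep = λ { zero → refl ; (suc i) → cong suc (T.class-rep i) }
    ; rep-class = λ { zero → ~-refl zero ; (suc x) → T.rep-class x } ; class-cong = λ {x} {y} → cls-cong x y }
    where
    cls : Fin (suc n) → Fin (suc T.size)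
    cls zero    = zero
    cls (suc x) = suc (T.class x)
    rep : Fin (suc T.size) → Fin (suc n)
    rep zero    = zero
    rep (suc i) = suc (T.rep i)
    zero-alone : ∀ {y} → ¬ zero ~ suc y
    zero-alone {y} zero~y = ¬zero~ (T.class y , ~-trans zero~y (T.rep-class y))
    cls-cong : ∀ x y → x ~ y → cls x ≡ cls y
    cls-cong zero    zero    _   = refl
    cls-cong zero    (suc y) x~y = contradiction x~y zero-alone
    cls-cong (suc x) zero    x~y = contradiction (~-sym x~y) zero-alone
    cls-cong (suc x) (suc y) x~y = cong suc (T.class-cong x~y)

-- The group of signed powers of 2

module Orbits (q : ℕ) (pr : Prime (suc q)) (3≤p : 3 ≤ suc q) (o : ℕ) (isOrder : IsOrder (suc q) 2 o) where

  open Residues q pr 3≤p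

  instance
    o-nonZero : NonZero o
    o-nonZero = ℕ.>-nonZero (IsOrder.positive isOrder)

  pow : ℕ → ℤ
  pow k = + (2 ^ k)

  pow-+ : ∀ a b → pow (a ℕ.+ b) ≡ pow a * pow b
  pow-+ a b = trans (cong +_ (ℕ.^-distribˡ-+-* 2 a b)) (ℤ.pos-* (2 ^ a) (2 ^ b))

  pow-o : pow o ≈ + 1
  pow-o = congruent (ℤ.∣ᵤ⇒∣ (subst (p ℕ.∣_) (∣m-n∣≡∣+m-+n∣ (2 ^ o) 1) (IsOrder.power isOrder)))

  pow-minimal : ∀ {j} → 1 ≤ j → pow j ≈ + 1 → o ≤ j
  pow-minimal {j} 1≤j e = IsOrder.minimal isOrder j 1≤j
    (subst (p ℕ.∣_) (sym (∣m-n∣≡∣+m-+n∣ (2 ^ j) 1)) (≈⇒∣ e))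

  pow≈1⇒≡0 : ∀ {j} → j < o → pow j ≈ + 1 → j ≡ 0
  pow≈1⇒≡0 {zero}  _   _ = refl
  pow≈1⇒≡0 {suc j} j<o e = contradiction (pow-minimal (s≤s z≤n) e) (ℕ.<⇒≱ j<o)

  pow-*o : ∀ k → pow (k ℕ.* o) ≈ + 1
  pow-*o zero    = ≈-refl
  pow-*o (suc k) = ≈-trans (≈-reflexive (pow-+ o (k ℕ.* o))) (*-cong pow-o (pow-*o k))

  pow-reduce : ∀ k → ∃ λ i → i < o × pow k ≈ pow i
  pow-reduce k = k ℕ.% o , ℕ.m%n<n k o ,
    ≈-trans (≈-reflexive (trans (cong pow (ℕ.m≡m%n+[m/n]*n k o)) (pow-+ (k ℕ.% o) _)))
    (≈-trans (*-cong (≈-refl {x = pow (k ℕ.% o)}) (pow-*o (k / o))) (≈-reflexive (ℤ.*-identityʳ _)))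

  pow≉0 : ∀ k → pow k ≉ + 0
  pow≉0 zero    = 1≉0
  pow≉0 (suc k) e = [ 2≉0 , pow≉0 k ]′ (*≈0 (+ 2) (pow k) (≈-trans (≈-reflexive (sym (pow-+ 1 k))) e))

  pow-cancel : ∀ a b → pow (a ℕ.+ b) ≈ pow a → pow b ≈ + 1
  pow-cancel a b e = *-cancelʳ (pow b) (+ 1) (pow≉0 a)
    (≈-trans (≈-reflexive (trans (ℤ.*-comm (pow b) (pow a)) (sym (pow-+ a b))))
             (≈-trans e (≈-reflexive (sym (ℤ.*-identityˡ (pow a))))))

  pow-injective : ∀ {i j} → i < o → j < o → pow i ≈ pow j → i ≡ j
  pow-injective {i} {j} i<o j<o e =
    [ (λ i≤j → ordered i≤j j<o e) , (λ j≤i → sym (ordered j≤i i<o (≈-sym e))) ]′ (ℕ.≤-total i j)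
    where
    ordered : ∀ {i j} → i ≤ j → j < o → pow i ≈ pow j → i ≡ j
    ordered {i} i≤j j<o e with d , refl ← ℕ.m≤n⇒∃[o]m+o≡n i≤j =
      trans (sym (ℕ.+-identityʳ i)) (cong (i ℕ.+_) (sym
        (pow≈1⇒≡0 (ℕ.≤-<-trans (ℕ.m≤n+m d i) j<o) (pow-cancel i d (≈-sym e)))))

  infix 4 _≈±_

  _≈±_ : ℤ → ℤ → Set
  x ≈± y = x ≈ y ⊎ x ≈ - y

  -- A listing of ⟨-1, 2⟩ modulo `p` without repetition, so `n` is the order of this group.
  record SignedPowers (n : ℕ) : Set where
    field
      elem           : Fin n → ℤ
      elem-injective : ∀ {i j} → elem i ≈ elem j → i ≡ j
      sound          : ∀ i → ∃ λ k → elem i ≈± pow k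
      complete⁺      : ∀ k → ∃ λ i → pow k ≈ elem i
      complete⁻      : ∀ k → ∃ λ i → - pow k ≈ elem i

  -- Half the order is a square root of 1 other than 1.
  -1-power : 2 ℕ.∣ o → ∃ λ e → pow e ≈ - + 1
  -1-power (ℕ.divides e o≡e*2) = e , [ (λ z → contradiction (pow-minimal 1≤e (from z)) (ℕ.<⇒≱ e<o)) , to ]′
    (*≈0 (pow e - + 1) (pow e + + 1) (≈-trans (≈-reflexive (lem (pow e))) (minus
      (≈-trans (≈-reflexive (trans (sym (pow-+ e e)) (cong pow (sym o≡e+e)))) pow-o))))
    where
    o≡e+e : o ≡ e ℕ.+ e
    o≡e+e = trans o≡e*2 (trans (ℕ.*-comm e 2) (cong (e ℕ.+_) (ℕ.+-identityʳ e)))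
    1≤e : 1 ≤ e
    1≤e = ℕ.n≢0⇒n>0 λ { refl → contradiction (subst (1 ≤_) o≡e+e (IsOrder.positive isOrder)) λ () }
    e<o : e < o
    e<o = subst (e <_) (sym o≡e+e) (ℕ.m<m+n e 1≤e)
    lem : ∀ x → (x - + 1) * (x + + 1) ≡ x * x - + 1
    lem = solve-∀
    minus : ∀ {x} → x ≈ + 1 → x - + 1 ≈ + 0
    minus x≈1 = +-cong x≈1 (≈-refl {x = - + 1})
    from : pow e - + 1 ≈ + 0 → pow e ≈ + 1
    from z = ≈-scale (+ 1) z (l (pow e))
      where l : ∀ x → x - + 1 ≡ + 1 * (x - + 1 - + 0)
            l = solve-∀
    to : pow e + + 1 ≈ + 0 → pow e ≈ - + 1
    to z = ≈-scale (+ 1) z (l (pow e))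
      where l : ∀ x → x - - + 1 ≡ + 1 * (x + + 1 - + 0)
            l = solve-∀

  -- If `2^i = -1` with `0 < i < o`, then `2^(2i) = 1` and `o ≤ 2i < 2o`; minimality of the order
  -- forces `2i = o`.
  -1-notPower : ¬ 2 ℕ.∣ o → ∀ k → pow k ≉ - + 1
  -1-notPower odd k e = let i , i<o , k≈i = pow-reduce k in absurd i i<o (≈-trans (≈-sym k≈i) e)
    where
    absurd : ∀ i → i < o → pow i ≉ - + 1
    absurd zero      i<o e = 2≉0 (≈-scale (+ 1) e refl)
    absurd i@(suc _) i<o e = odd (ℕ.divides i (trans (sym (ℕ.+-identityʳ o)) (trans (cong (o ℕ.+_) (sym d≡0))
        (trans o+d≡i+i (trans (cong (i ℕ.+_) (sym (ℕ.+-identityʳ i))) (ℕ.*-comm 2 i))))))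
      where
      square : pow (i ℕ.+ i) ≈ + 1
      square = ≈-trans (≈-reflexive (pow-+ i i)) (*-cong e e)
      o≤i+i : o ≤ i ℕ.+ i
      o≤i+i = pow-minimal (s≤s z≤n) square
      d : ℕ
      d = i ℕ.+ i ∸ o
      o+d≡i+i : o ℕ.+ d ≡ i ℕ.+ i
      o+d≡i+i = ℕ.m+[n∸m]≡n o≤i+i
      d≡0 : d ≡ 0
      d≡0 = pow≈1⇒≡0 (ℕ.+-cancelˡ-< o d o (subst (_< o ℕ.+ o) (sym o+d≡i+i) (ℕ.+-mono-< i<o i<o)))
              (pow-cancel o d (≈-trans (≈-reflexive (cong pow o+d≡i+i)) (≈-trans square (≈-sym pow-o))))

  -- The origin of `c`: for even order -1 is already a power of 2, for odd order the powers and
  -- their negatives are disjoint. Taking the decision as an argument makes the size compute to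
  -- `c p * ord p 2`.
  signedPowers : (d : Dec (2 ℕ.∣ o)) → SignedPowers ((if does d then 1 else 2) ℕ.* o)
  signedPowers (yes even) = subst SignedPowers (sym (ℕ.*-identityˡ o)) (record
    { elem = pow ∘ toℕ
    ; elem-injective = λ {i} {j} e → Fin.toℕ-injective (pow-injective (Fin.toℕ<n i) (Fin.toℕ<n j) e)
    ; sound = λ i → toℕ i , inj₁ ≈-refl
    ; complete⁺ = complete⁺
    ; complete⁻ = λ k → let e , pow-e = -1-power even ; i , k≈i = complete⁺ (e ℕ.+ k) in
        i , ≈-trans (≈-reflexive (sym (ℤ.-1*i≡-i (pow k)))) (≈-trans (*-cong (≈-sym pow-e) (≈-refl {x = pow k}))
              (≈-trans (≈-reflexive (sym (pow-+ e k))) k≈i)) })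
    where
    complete⁺ : ∀ k → ∃ λ (i : Fin o) → pow k ≈ pow (toℕ i)
    complete⁺ k = let i , i<o , k≈i = pow-reduce k in
      fromℕ< i<o , ≈-trans k≈i (≈-reflexive (cong pow (sym (Fin.toℕ-fromℕ< i<o))))
  signedPowers (no odd) = record
    { elem = λ i → elem (Fin.remQuot o i)
    ; elem-injective = λ {i} {j} e → trans (sym (Fin.combine-remQuot {2} o i))
        (trans (cong (λ z → Fin.combine (proj₁ z) (proj₂ z)) (injective (Fin.remQuot {2} o i) (Fin.remQuot o j) e))
        (Fin.combine-remQuot {2} o j))
    ; sound = λ i → sound (Fin.remQuot o i)
    ; complete⁺ = complete zero
    ; complete⁻ = complete (suc zero) }
    where
    elem : Fin 2 × Fin o → ℤ
    elem (zero     , j) = pow (toℕ j)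
    elem (suc zero , j) = - pow (toℕ j)

    mixed : ∀ i {j} → j < o → pow i ≉ - pow j
    mixed i {j} j<o e = -1-notPower odd (i ℕ.+ (o ∸ j))
      (≈-trans (≈-reflexive (pow-+ i (o ∸ j))) (≈-trans (*-cong e (≈-refl {x = pow (o ∸ j)}))
      (≈-trans (≈-reflexive (trans (sym (ℤ.neg-distribˡ-* (pow j) (pow (o ∸ j)))) (cong (-_)
        (trans (sym (pow-+ j (o ∸ j))) (cong pow (ℕ.m+[n∸m]≡n (ℕ.<⇒≤ j<o))))))) (neg-cong pow-o))))

    injective : ∀ x y → elem x ≈ elem y → x ≡ y
    injective (zero     , i) (zero     , j) e =
      cong (zero ,_) (Fin.toℕ-injective (pow-injective (Fin.toℕ<n i) (Fin.toℕ<n j) e))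
    injective (zero     , i) (suc zero , j) e = contradiction e (mixed (toℕ i) (Fin.toℕ<n j))
    injective (suc zero , i) (zero     , j) e = contradiction (≈-sym e) (mixed (toℕ j) (Fin.toℕ<n i))
    injective (suc zero , i) (suc zero , j) e = cong (suc zero ,_) (Fin.toℕ-injective
      (pow-injective (Fin.toℕ<n i) (Fin.toℕ<n j)
        (subst₂ _≈_ (ℤ.neg-involutive _) (ℤ.neg-involutive _) (neg-cong e))))

    sound : ∀ x → ∃ λ k → elem x ≈± pow k
    sound (zero     , j) = toℕ j , inj₁ ≈-refl
    sound (suc zero , j) = toℕ j , inj₂ ≈-refl

    signed : Fin 2 → ℤ → ℤ
    signed zero     x = x
    signed (suc zero) x = - x

    complete : ∀ s k → ∃ λ i → signed s (pow k) ≈ elem (Fin.remQuot {2} o i)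
    complete s k = let i , i<o , k≈i = pow-reduce k in
      Fin.combine s (fromℕ< i<o) ,
      ≈-trans (step s (≈-trans k≈i (≈-reflexive (cong pow (sym (Fin.toℕ-fromℕ< i<o))))))
              (≈-reflexive (cong elem (sym (Fin.remQuot-combine s (fromℕ< i<o)))))
      where
      step : ∀ s {j} → pow k ≈ pow (toℕ j) → signed s (pow k) ≈ elem (s , j)
      step zero       e = e
      step (suc zero) e = neg-cong e

-- Orbits on nonzero residues and their number

module OrbitClasses (q : ℕ) (pr : Prime (suc q)) (3≤p : 3 ≤ suc q) (o : ℕ) (isOrder : IsOrder (suc q) 2 o)
  {n : ℕ} (S : Orbits.SignedPowers q pr 3≤p o isOrder n) where

  open Residues q pr 3≤p
  open Orbits q pr 3≤p o isOrder
  open SignedPowers S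

  ≈±-trans : ∀ {x y z} → x ≈± y → y ≈± z → x ≈± z
  ≈±-trans (inj₁ e) (inj₁ f) = inj₁ (≈-trans e f)
  ≈±-trans (inj₁ e) (inj₂ f) = inj₂ (≈-trans e f)
  ≈±-trans (inj₂ e) (inj₁ f) = inj₂ (≈-trans e (neg-cong f))
  ≈±-trans (inj₂ e) (inj₂ f) = inj₁ (≈-trans e (≈-trans (neg-cong f) (≈-reflexive (ℤ.neg-involutive _))))

  ≈±-sym : ∀ {x y} → x ≈± y → y ≈± x
  ≈±-sym (inj₁ e) = inj₁ (≈-sym e)
  ≈±-sym (inj₂ e) = inj₂ (≈-trans (≈-reflexive (sym (ℤ.neg-involutive _))) (neg-cong (≈-sym e)))

  ≈±-*ˡ : ∀ a {x y} → x ≈± y → a * x ≈± a * y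
  ≈±-*ˡ a (inj₁ e) = inj₁ (*-cong (≈-refl {x = a}) e)
  ≈±-*ˡ a (inj₂ e) = inj₂ (≈-trans (*-cong (≈-refl {x = a}) e) (≈-reflexive (sym (ℤ.neg-distribʳ-* a _))))

  ≈±-*ʳ : ∀ a {x y} → x ≈± y → x * a ≈± y * a
  ≈±-*ʳ a {x} {y} e = subst₂ _≈±_ (ℤ.*-comm a x) (ℤ.*-comm a y) (≈±-*ˡ a e)

  infix 4 _~_

  record _~_ (x y : ℤ) : Set where
    constructor related
    field
      exponent : ℕ
      signed   : x ≈± pow exponent * y

  ~-refl : ∀ {x} → x ~ x
  ~-refl {x} = related 0 (inj₁ (≈-reflexive (sym (ℤ.*-identityˡ x))))

  ~-trans : ∀ {x y z} → x ~ y → y ~ z → x ~ z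
  ~-trans {z = z} (related k e) (related l f) = related (k ℕ.+ l) (≈±-trans e (≈±-trans (≈±-*ˡ (pow k) f)
    (inj₁ (≈-reflexive (trans (sym (ℤ.*-assoc (pow k) (pow l) z)) (cong (_* z) (sym (pow-+ k l))))))))

  ~-sym : ∀ {x y} → x ~ y → y ~ x
  ~-sym {x} {y} (related k e) = related l (≈±-sym (≈±-trans (≈±-*ˡ (pow l) e) (inj₁ cancel)))
    where
    -- An exponent for the inverse of `2^k` that stays natural: `l + k` is the multiple `k * o` of
    -- the order.
    l : ℕ
    l = k ℕ.* ℕ.pred o
    l+k≡ko : l ℕ.+ k ≡ k ℕ.* o
    l+k≡ko = trans (ℕ.+-comm l k) (trans (sym (ℕ.*-suc k (ℕ.pred o))) (cong (k ℕ.*_) (ℕ.suc-pred o)))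
    cancel : pow l * (pow k * y) ≈ y
    cancel = ≈-trans (≈-reflexive (trans (sym (ℤ.*-assoc (pow l) (pow k) y))
                       (cong (_* y) (trans (sym (pow-+ l k)) (cong pow l+k≡ko)))))
               (≈-trans (*-cong (pow-*o k) ≈-refl) (≈-reflexive (ℤ.*-identityˡ y)))

  ≈⇒~ : ∀ {x y} → x ≈ y → x ~ y
  ≈⇒~ {y = y} e = related 0 (inj₁ (≈-trans e (≈-reflexive (sym (ℤ.*-identityˡ y)))))

  double~ : ∀ x → x + x ~ x
  double~ x = related 1 (inj₁ (≈-reflexive (lem x)))
    where lem : ∀ x → x + x ≡ + 2 * x
          lem = solve-∀

  neg~ : ∀ x → - x ~ x
  neg~ x = related 0 (inj₂ (≈-reflexive (cong -_ (sym (ℤ.*-identityˡ x)))))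

  ~⇒elem : ∀ {x y} → x ~ y → ∃ λ i → x ≈ elem i * y
  ~⇒elem (related k (inj₁ e)) = let i , k≈i = complete⁺ k in i , ≈-trans e (*-cong k≈i ≈-refl)
  ~⇒elem {y = y} (related k (inj₂ e)) = let i , -k≈i = complete⁻ k in
    i , ≈-trans e (≈-trans (≈-reflexive (ℤ.neg-distribˡ-* (pow k) y)) (*-cong -k≈i ≈-refl))

  elem⇒~ : ∀ {x y} i → x ≈ elem i * y → x ~ y
  elem⇒~ {y = y} i e = let k , ek = sound i in related k (≈±-trans (inj₁ e) (≈±-*ʳ y ek))

  opaque
    -- The exponent in `_~_` is unbounded, so the search runs over the finite listing of the group.
    _~?_ : ∀ x y → Dec (x ~ y)
    x ~? y = map′ (λ (i , e) → elem⇒~ i e) ~⇒elem (Fin.any? λ i → x ≈? (elem i * y))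

  nz : Fin q → ℤ
  nz i = ⟦ suc i ⟧

  opaque
    nz≉0 : ∀ i → nz i ≉ + 0
    nz≉0 i e with () ← ⟦⟧-injective {suc i} {zero} e

    nonzero : ∀ {x} → x ≉ + 0 → ∃ λ i → nz i ≈ x
    nonzero {x} x≉0 with residue x | ⟦residue⟧ x
    ... | zero  | e = contradiction (≈-sym e) x≉0
    ... | suc i | e = i , e

  nz-injective : ∀ {i j} → nz i ≈ nz j → i ≡ j
  nz-injective = Fin.suc-injective ∘ ⟦⟧-injective

  opaque
    elem≉0 : ∀ i → elem i ≉ + 0
    elem≉0 i e with sound i
    ... | k , inj₁ f = pow≉0 k (≈-trans (≈-sym f) e)
    ... | k , inj₂ f = pow≉0 k (≈-trans (≈-reflexive (sym (ℤ.neg-involutive _))) (neg-cong (≈-trans (≈-sym f) e)))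

    orbits : Quotient (λ i j → nz i ~ nz j)
    orbits = quotient (λ _ → ~-refl) ~-sym ~-trans (λ i j → nz i ~? nz j)

  open Quotient orbits public

  -- The action is free because a nonzero representative can be cancelled. Pairs of an orbit and a
  -- group element thus inject into the nonzero residues, and conversely by taking coordinates.
  orbit-count : size ℕ.* n ≡ q
  orbit-count = Fin.cantor-schröder-bernstein
    {f = λ i → proj₁ (point (Fin.remQuot n i))} {g = λ x → Fin.combine (class x) (proj₁ (coordinate x))}
    (λ {i} {j} e → trans (sym (Fin.combine-remQuot {size} n i)) (trans
      (cong (λ z → Fin.combine (proj₁ z) (proj₂ z)) (point-injective (Fin.remQuot n i) (Fin.remQuot n j) e))
      (Fin.combine-remQuot {size} n j)))
    (λ {x} {y} e → let class≡ , coord≡ = Fin.combine-injective (class x) _ (class y) _ e in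
      nz-injective (≈-trans (proj₂ (coordinate x)) (≈-trans
        (≈-reflexive (cong₂ (λ k i → elem k * nz (rep i)) coord≡ class≡)) (≈-sym (proj₂ (coordinate y))))))
    where
    coordinate : ∀ x → ∃ λ k → nz x ≈ elem k * nz (rep (class x))
    coordinate x = ~⇒elem (rep-class x)

    point : ∀ ((i , k) : Fin size × Fin n) → ∃ λ x → nz x ≈ elem k * nz (rep i)
    point (i , k) = nonzero ([ elem≉0 k , nz≉0 (rep i) ]′ ∘ *≈0 (elem k) (nz (rep i)))

    class-point : ∀ z → class (proj₁ (point z)) ≡ proj₁ z
    class-point (i , k) = trans (class-cong (elem⇒~ k (proj₂ (point (i , k))))) (class-rep i)

    point-injective : ∀ y z → proj₁ (point y) ≡ proj₁ (point z) → y ≡ z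
    point-injective y@(i , k) z@(j , l) e
      with refl ← trans (sym (class-point y)) (trans (cong class e) (class-point z)) =
      cong (i ,_) (elem-injective (*-cancelʳ (elem k) (elem l) (nz≉0 (rep i))
        (≈-trans (≈-sym (proj₂ (point y))) (≈-trans (≈-reflexive (cong nz e)) (proj₂ (point z))))))

-- Enumerating colourings

record Selection {A : Set} (P : A → Set) {m} (f : Fin m → A) (l : ℕ) : Set where
  field
    index     : Fin l → Fin m
    injective : Injective _≡_ _≡_ index
    sound     : ∀ i → P (f (index i))
    complete  : ∀ {j} → P (f j) → ∃ λ i → index i ≡ j

filter-selection : ∀ {A : Set} {P : A → Set} (P? : Decidable P) {m} (f : Fin m → A) →
                   Selection P f (length (filter P? (tabulate f)))
filter-selection P? {zero}  f = record
  { index = λ () ; injective = λ { {()} } ; sound = λ () ; complete = λ { {()} } }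
filter-selection P? {suc m} f with filter-selection P? (f ∘ suc) | P? (f zero)
... | tail | yes P0 = record
  { index     = index
  ; injective = injective
  ; sound     = λ { zero → P0 ; (suc i) → T.sound i }
  ; complete  = λ { {zero} _ → zero , refl ; {suc j} Pj → let i , e = T.complete Pj in suc i , cong suc e }
  }
  where
  module T = Selection tail
  index : Fin _ → Fin (suc m)
  index zero    = zero
  index (suc i) = suc (T.index i)
  injective : Injective _≡_ _≡_ index
  injective {zero}  {zero}  _ = refl
  injective {zero}  {suc _} ()
  injective {suc _} {zero}  ()
  injective {suc i} {suc j} e = cong suc (T.injective (Fin.suc-injective e))
... | tail | no ¬P0 = record
  { index     = suc ∘ T.index
  ; injective = T.injective ∘ Fin.suc-injective
  ; sound     = T.sound
  ; complete  = λ { {zero} P0 → contradiction P0 ¬P0 ; {suc j} Pj → let i , e = T.complete Pj in i , cong suc e }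
  }
  where module T = Selection tail

-- Colourings are compared pointwise, in keeping with `finToFun`, which lists one function for each
-- pointwise class.
record Enumerates (I : Set) {n k} (P : (Fin n → Fin k) → Set) : Set where
  field
    enum      : I → Fin n → Fin k
    injective : ∀ {i j} → enum i ≗ enum j → i ≡ j
    sound     : ∀ i → P (enum i)
    complete  : ∀ {f} → P f → ∃ λ i → enum i ≗ f

module _ {n k} {P Q : (Fin n → Fin k) → Set} where

  enumerates-⇔ : ∀ {I} → Enumerates I P → (∀ {f} → P f → Q f) → (∀ {f} → Q f → P f) → Enumerates I Q
  enumerates-⇔ E P⇒Q Q⇒P = record
    { enum = E.enum ; injective = E.injective ; sound = P⇒Q ∘ E.sound ; complete = E.complete ∘ Q⇒P }
    where module E = Enumerates E

  enumerates-⊎ : ∀ {I J} → Enumerates I P → Enumerates J Q → (∀ {f f′} → f ≗ f′ → P f → ¬ Q f′) →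
                 Enumerates (I ⊎ J) (λ f → P f ⊎ Q f)
  enumerates-⊎ {I} {J} E F disjoint = record
    { enum = enum ; injective = λ {x} {y} → injective x y ; sound = sound ; complete = complete }
    where
    module E = Enumerates E
    module F = Enumerates F
    enum : I ⊎ J → Fin n → Fin k
    enum = [ E.enum , F.enum ]′
    injective : ∀ x y → enum x ≗ enum y → x ≡ y
    injective (inj₁ i) (inj₁ j) e = cong inj₁ (E.injective e)
    injective (inj₁ i) (inj₂ j) e = contradiction (F.sound j) (disjoint e (E.sound i))
    injective (inj₂ i) (inj₁ j) e = contradiction (F.sound i) (disjoint (sym ∘ e) (E.sound j))
    injective (inj₂ i) (inj₂ j) e = cong inj₂ (F.injective e)
    sound : ∀ x → P (enum x) ⊎ Q (enum x)
    sound (inj₁ i) = inj₁ (E.sound i)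
    sound (inj₂ j) = inj₂ (F.sound j)
    complete : ∀ {f} → P f ⊎ Q f → ∃ λ x → enum x ≗ f
    complete (inj₁ Pf) = let i , e = E.complete Pf in inj₁ i , e
    complete (inj₂ Qf) = let j , e = F.complete Qf in inj₂ j , e

funToFin-cong : ∀ {n k} {f f′ : Fin n → Fin k} → f ≗ f′ → Fin.funToFin f ≡ Fin.funToFin f′
funToFin-cong {zero}  e = refl
funToFin-cong {suc n} e = cong₂ Fin.combine (e zero) (funToFin-cong (e ∘ suc))

finToFun-injective : ∀ {n k} {i j : Fin (k ^ n)} → Fin.finToFun {k} {n} i ≗ Fin.finToFun j → i ≡ j
finToFun-injective {n} {k} {i} {j} e =
  trans (sym (Fin.funToFin-finToFin {n} {k} i)) (trans (funToFin-cong e) (Fin.funToFin-finToFin {n} {k} j))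

-- Two injections: a kept position goes to the index of its colouring, and an index to the code of
-- its colouring under `funToFin`. `resp` transports `P` to the decoded function.
filter-length : ∀ {I N n k} {P : (Fin n → Fin k) → Set} (P? : Decidable P) → (∀ {f f′} → f ≗ f′ → P f → P f′) →
                Enumerates I P → I ↔ Fin N → length (filter P? (tabulate {n = k ^ n} Fin.finToFun)) ≡ N
filter-length {I} {N} {n} {k} {P} P? resp E I↔N = Fin.cantor-schröder-bernstein
  {f = λ i → to (proj₁ (E.complete (S.sound i)))} {g = proj₁ ∘ preimage}
  (λ {i} {j} e → S.injective (finToFun-injective {n} {k} λ x →
    trans (sym (proj₂ (E.complete (S.sound i)) x)) (trans (cong (λ z → E.enum z x) (to-injective e))
      (proj₂ (E.complete (S.sound j)) x))))
  (λ {i} {j} e → from-injective (E.injective λ x →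
    trans (sym (Fin.finToFun-funToFin (E.enum (from i)) x)) (trans
      (cong (λ z → Fin.finToFun z x) (trans (sym (proj₂ (preimage i))) (trans (cong S.index e) (proj₂ (preimage j)))))
      (Fin.finToFun-funToFin (E.enum (from j)) x))))
  where
  open Inverse I↔N
  module E = Enumerates E
  selection : Selection P (Fin.finToFun {k} {n}) _
  selection = filter-selection P? Fin.finToFun
  module S = Selection selection
  to-injective : ∀ {x y} → to x ≡ to y → x ≡ y
  to-injective {x} {y} e = trans (sym (strictlyInverseʳ x)) (trans (cong from e) (strictlyInverseʳ y))
  from-injective : ∀ {x y} → from x ≡ from y → x ≡ y
  from-injective {x} {y} e = trans (sym (strictlyInverseˡ x)) (trans (cong to e) (strictlyInverseˡ y))
  preimage : ∀ i → ∃ λ j → S.index j ≡ Fin.funToFin (E.enum (from i))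
  preimage i = S.complete (resp (sym ∘ Fin.finToFun-funToFin (E.enum (from i))) (E.sound (from i)))

-- Constant and two-valued colourings

Constant : ∀ {n k} → (Fin n → Fin k) → Set
Constant f = ∀ x y → f x ≡ f y

-- On an empty domain all constants would coincide, hence `suc n`.
constants : ∀ {n k} → Enumerates (Fin k) (Constant {suc n} {k})
constants = record
  { enum = λ a _ → a ; injective = λ e → e zero ; sound = λ _ _ _ → refl
  ; complete = λ {f} const → f zero , const zero }

TwoValued : ∀ {n k} → (Fin n → Fin k) → Set
TwoValued f = ∃₂ λ b c → b ≢ c × (∀ x → f x ≡ b ⊎ f x ≡ c) × (∃ λ x → f x ≡ b) × (∃ λ x → f x ≡ c)

twoValued-noThree : ∀ {n k} {f : Fin n → Fin k} → TwoValued f → ∀ x y z → ¬ Distinct (f x) (f y) (f z)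
twoValued-noThree (b , c , _ , cover , _) x y z (x≢y , y≢z , x≢z) with cover x | cover y | cover z
... | inj₁ p | inj₁ q | _      = x≢y (trans p (sym q))
... | inj₂ p | inj₂ q | _      = x≢y (trans p (sym q))
... | inj₁ p | inj₂ q | inj₁ s = x≢z (trans p (sym s))
... | inj₁ p | inj₂ q | inj₂ s = y≢z (trans q (sym s))
... | inj₂ p | inj₁ q | inj₁ s = y≢z (trans q (sym s))
... | inj₂ p | inj₁ q | inj₂ s = x≢z (trans p (sym s))

module NonzeroBits (n : ℕ) where

  -- `punchIn` in a form that accepts `2 ^ n`, which does not reduce to a successor.
  omit : ∀ {m} → Fin m → Fin (m ∸ 1) → Fin m
  omit {suc m} = Fin.punchIn

  omit-≢ : ∀ {m} (z : Fin m) i → omit z i ≢ z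
  omit-≢ {suc m} = Fin.punchInᵢ≢i

  omit-injective : ∀ {m} (z : Fin m) {i j} → omit z i ≡ omit z j → i ≡ j
  omit-injective {suc m} z = Fin.punchIn-injective z _ _

  omit-surjective : ∀ {m} (z : Fin m) {x} → z ≢ x → ∃ λ i → omit z i ≡ x
  omit-surjective {suc m} z z≢x = Fin.punchOut z≢x , Fin.punchIn-punchOut z≢x

  Mask : Set
  Mask = Fin (2 ^ n ∸ 1)

  origin : Fin (2 ^ n)
  origin = Fin.funToFin {n} {2} λ _ → zero

  bits : Mask → Fin n → Fin 2
  bits w = Fin.finToFun (omit origin w)

  bits-injective : ∀ {v w} → bits v ≗ bits w → v ≡ w
  bits-injective e = omit-injective origin (finToFun-injective {n} {2} e)

  bits-nonzero : ∀ w → ∃ λ i → bits w i ≡ suc zero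
  bits-nonzero w with i , wi≢0 ← Fin.¬∀⟶∃¬ n (λ i → bits w i ≡ zero) (λ i → bits w i Fin.≟ zero)
                      (λ all0 → omit-≢ origin w (finToFun-injective {n} {2} λ i →
                        trans (all0 i) (sym (Fin.finToFun-funToFin {n} {2} (λ _ → zero) i))))
    = i , isOne wi≢0
    where
    isOne : ∀ {x : Fin 2} → x ≢ zero → x ≡ suc zero
    isOne {zero}     x≢0 = contradiction refl x≢0
    isOne {suc zero} _   = refl

  bits-complete : ∀ (u : Fin n → Fin 2) i → u i ≢ zero → ∃ λ w → bits w ≗ u
  bits-complete u i ui≢0 with w , e ← omit-surjective origin {Fin.funToFin u} (λ e → ui≢0
      (trans (sym (Fin.finToFun-funToFin u i)) (trans (cong (λ z → Fin.finToFun z i) (sym e))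
        (Fin.finToFun-funToFin {n} {2} (λ _ → zero) i))))
    = w , λ j → trans (cong (λ z → Fin.finToFun z j) e) (Fin.finToFun-funToFin u j)

-- The colour of 0, the other colour, and the set of points of the other colour.
-- The index set is empty for n = 0, because 2 ^ 0 ∸ 1 = 0.
TwoValuedIndex : ℕ → ℕ → Set
TwoValuedIndex n k = Fin k × Fin (k ∸ 1) × Fin (2 ^ (n ∸ 1) ∸ 1)

twoValued : ∀ n k → Enumerates (TwoValuedIndex n k) (TwoValued {n} {k})
twoValued zero k = record
  { enum = λ { (_ , _ , ()) } ; injective = λ { {_ , _ , ()} } ; sound = λ { (_ , _ , ()) }
  ; complete = λ { (_ , _ , _ , _ , (() , _) , _) } }
twoValued (suc n) zero = record
  { enum = λ () ; injective = λ { {()} } ; sound = λ ()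
  ; complete = λ { (() , _) } }
twoValued (suc n) (suc k) = record { enum = enum ; injective = injective ; sound = sound ; complete = complete }
  where
  open NonzeroBits n

  choose : ∀ {A : Set} → A → A → Fin 2 → A
  choose b c zero       = b
  choose b c (suc zero) = c

  choose-injective : ∀ {A : Set} {b c : A} → b ≢ c → ∀ x y → choose b c x ≡ choose b c y → x ≡ y
  choose-injective b≢c zero       zero       _ = refl
  choose-injective b≢c zero       (suc zero) e = contradiction e b≢c
  choose-injective b≢c (suc zero) zero       e = contradiction (sym e) b≢c
  choose-injective b≢c (suc zero) (suc zero) _ = refl

  choose-cover : ∀ {A : Set} {b c : A} x → choose b c x ≡ b ⊎ choose b c x ≡ c
  choose-cover zero       = inj₁ refl
  choose-cover (suc zero) = inj₂ refl

  enum : TwoValuedIndex (suc n) (suc k) → Fin (suc n) → Fin (suc k)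
  enum (b , d , w) zero    = b
  enum (b , d , w) (suc i) = choose b (Fin.punchIn b d) (bits w i)

  ≢punchIn : ∀ (b : Fin (suc k)) d → b ≢ Fin.punchIn b d
  ≢punchIn b d = Fin.punchInᵢ≢i b d ∘ sym

  -- A nonzero mask shows the second colour somewhere, and there the other colouring can only show
  -- its own second colour.
  other-injective : ∀ b d w d′ w′ → enum (b , d , w) ≗ enum (b , d′ , w′) → d ≡ d′
  other-injective b d w d′ w′ e with i , wi≡1 ← bits-nonzero w
    with e (suc i) | choose-cover {b = b} {Fin.punchIn b d′} (bits w′ i)
  ... | ei | inj₁ f rewrite wi≡1 = contradiction (trans ei f) (Fin.punchInᵢ≢i b d)
  ... | ei | inj₂ f rewrite wi≡1 = Fin.punchIn-injective b d d′ (trans ei f)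

  injective : ∀ {i j} → enum i ≗ enum j → i ≡ j
  injective {b , d , w} {b′ , d′ , w′} e with refl ← e zero with refl ← other-injective b d w d′ w′ e =
    cong (λ z → b , d , z) (bits-injective λ i → choose-injective (≢punchIn b d) _ _ (e (suc i)))

  sound : ∀ i → TwoValued (enum i)
  sound (b , d , w) = b , Fin.punchIn b d , ≢punchIn b d ,
    (λ { zero → inj₁ refl ; (suc i) → choose-cover (bits w i) }) , (zero , refl) ,
    let i , wi≡1 = bits-nonzero w in suc i , cong (choose b (Fin.punchIn b d)) wi≡1

  fromHead : ∀ (f : Fin (suc n) → Fin (suc k)) {c} → f zero ≢ c → (∀ x → f x ≡ f zero ⊎ f x ≡ c) →
             (∃ λ x → f x ≡ c) → ∃ λ i → enum i ≗ f
  fromHead f b≢c cover (zero  , e) = contradiction e b≢c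
  fromHead f {c} b≢c cover (suc x , e) = (f zero , Fin.punchOut b≢c , proj₁ mask) , agrees
    where
    bit : ∀ {a} → Dec (a ≡ f zero) → Fin 2
    bit (yes _) = zero
    bit (no _)  = suc zero
    u : Fin n → Fin 2
    u i = bit (f (suc i) Fin.≟ f zero)
    ux≢0 : u x ≢ zero
    ux≢0 with f (suc x) Fin.≟ f zero
    ... | yes x≡b = contradiction (trans (sym x≡b) e) b≢c
    ... | no  _   = λ ()
    mask : ∃ λ w → bits w ≗ u
    mask = bits-complete u x ux≢0
    choose-u : ∀ i → choose (f zero) c (u i) ≡ f (suc i)
    choose-u i with f (suc i) Fin.≟ f zero | cover (suc i)
    ... | yes i≡b | _        = sym i≡b
    ... | no  i≢b | inj₁ i≡b = contradiction i≡b i≢b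
    ... | no  _   | inj₂ i≡c = sym i≡c
    agrees : enum (f zero , Fin.punchOut b≢c , proj₁ mask) ≗ f
    agrees zero    = refl
    agrees (suc i) = trans (cong₂ (choose (f zero)) (Fin.punchIn-punchOut b≢c) (proj₂ mask i)) (choose-u i)

  complete : ∀ {f} → TwoValued f → ∃ λ i → enum i ≗ f
  complete {f} (b , c , b≢c , cover , someB , someC) with cover zero
  ... | inj₁ refl = fromHead f b≢c cover someC
  ... | inj₂ refl = fromHead f (b≢c ∘ sym) ([ inj₂ , inj₁ ]′ ∘ cover) someB

-- Colourings with at least three colours

merge : ∀ {r} → Fin r → Fin r → Fin r → Colour
merge a b t with t Fin.≟ a | t Fin.≟ b
... | yes _ | _     = zero
... | no _  | yes _ = suc zero
... | no _  | no _  = suc (suc zero)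

module _ {r} {a b : Fin r} where

  merge-first : merge a b a ≡ zero
  merge-first with a Fin.≟ a | a Fin.≟ b
  ... | yes _  | _ = refl
  ... | no a≢a | _ = contradiction refl a≢a

  merge-second : a ≢ b → merge a b b ≡ suc zero
  merge-second a≢b with b Fin.≟ a | b Fin.≟ b
  ... | yes b≡a | _      = contradiction (sym b≡a) a≢b
  ... | no _    | yes _  = refl
  ... | no _    | no b≢b = contradiction refl b≢b

  merge-rest : ∀ {t} → t ≢ a → t ≢ b → merge a b t ≡ suc (suc zero)
  merge-rest {t} t≢a t≢b with t Fin.≟ a | t Fin.≟ b
  ... | yes t≡a | _       = contradiction t≡a t≢a
  ... | no _    | yes t≡b = contradiction t≡b t≢b
  ... | no _    | no _    = refl

twoOthers : ∀ {r} {a b c : Fin r} → Distinct a b c → ∀ t →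
            (t ≢ a × t ≢ b) ⊎ (t ≢ a × t ≢ c) ⊎ (t ≢ b × t ≢ c)
twoOthers {a = a} {b} (a≢b , b≢c , a≢c) t with t Fin.≟ a | t Fin.≟ b
... | yes refl | _        = inj₂ (inj₂ (a≢b , a≢c))
... | no t≢a   | yes refl = inj₂ (inj₁ (t≢a , b≢c))
... | no t≢a   | no t≢b   = inj₁ (t≢a , t≢b)

ThreeColoured : ∀ {r p} → Coloring r p → Set
ThreeColoured f = ∃ λ x → ∃₂ λ y z → Distinct (f x) (f y) (f z)

module ThreeColouredCount (q : ℕ) (pr : Prime (suc q)) (3≤p : 3 ≤ suc q) (o : ℕ) (isOrder : IsOrder (suc q) 2 o)
  {n : ℕ} (S : Orbits.SignedPowers q pr 3≤p o isOrder n) (k : ℕ) where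

  open Residues q pr 3≤p
  open Orbits q pr 3≤p o isOrder
  open OrbitClasses q pr 3≤p o isOrder S

  r : ℕ
  r = suc k

  2*-+ : ∀ m → + (2 ℕ.* m) ≡ + m + + m
  2*-+ m = cong (λ t → + (m ℕ.+ t)) (ℕ.+-identityʳ m)

  opaque
    AP₃⇒≈ : ∀ (x y z : Fin p) → AP₃ x y z → ⟦ x ⟧ + ⟦ z ⟧ ≈ ⟦ y ⟧ + ⟦ y ⟧
    AP₃⇒≈ x y z d = congruent (ℤ.∣ᵤ⇒∣ (subst (p ℕ.∣_) (trans (∣m-n∣≡∣+m-+n∣ (toℕ x ℕ.+ toℕ z) (2 ℕ.* toℕ y))
      (cong (λ t → ∣ ⟦ x ⟧ + ⟦ z ⟧ - t ∣) (2*-+ (toℕ y)))) d))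

    ≈⇒AP₃ : ∀ (x y z : Fin p) → ⟦ x ⟧ + ⟦ z ⟧ ≈ ⟦ y ⟧ + ⟦ y ⟧ → AP₃ x y z
    ≈⇒AP₃ x y z e = subst (p ℕ.∣_) (sym (trans (∣m-n∣≡∣+m-+n∣ (toℕ x ℕ.+ toℕ z) (2 ℕ.* toℕ y))
      (cong (λ t → ∣ ⟦ x ⟧ + ⟦ z ⟧ - t ∣) (2*-+ (toℕ y))))) (≈⇒∣ e)

  module Structure (f : Coloring r p) (rf : RainbowFree f) where

    F : ℤ → Fin r
    F x = f (residue x)

    F-cong : ∀ {x y} → x ≈ y → F x ≡ F y
    F-cong = cong f ∘ residue-cong

    F-rainbowFree : ∀ x y z → x + z ≈ y + y → ¬ Distinct (F x) (F y) (F z)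
    F-rainbowFree x y z e = rf (residue x) (residue y) (residue z) (≈⇒AP₃ (residue x) (residue y) (residue z)
      (≈-trans (+-cong (⟦residue⟧ x) (⟦residue⟧ z)) (≈-trans e (≈-sym (+-cong (⟦residue⟧ y) (⟦residue⟧ y))))))

    opaque
      -- Points with different merged colours had different colours before, so merging creates no
      -- rainbow.
      mergedSingleton : ∀ u v w → Distinct (F u) (F v) (F w) →
        ∃ λ x → ∀ y → merge (F u) (F v) (F y) ≡ merge (F u) (F v) (F x) → y ≈ x
      mergedSingleton u v w (u≢v , v≢w , u≢w) = ThreeColours.singletonClass q pr 3≤p
        G (cong (merge (F u) (F v)) ∘ F-cong)
        (λ x y z e {X} {Y} {Z} Gx Gy Gz (X≢Y , Y≢Z , X≢Z) → F-rainbowFree x y z (≈-reflexive e)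
          (reflects Gx Gy X≢Y , reflects Gy Gz Y≢Z , reflects Gx Gz X≢Z))
        λ where
          zero             → u , merge-first
          (suc zero)       → v , merge-second u≢v
          (suc (suc zero)) → w , merge-rest (u≢w ∘ sym) (v≢w ∘ sym)
        where
        G : ℤ → Colour
        G x = merge (F u) (F v) (F x)
        reflects : ∀ {x y X Y} → G x ≡ X → G y ≡ Y → X ≢ Y → F x ≢ F y
        reflects Gx Gy X≢Y e = X≢Y (trans (sym Gx) (trans (cong (merge (F u) (F v)) e) Gy))

    module Centred (x₀ : ℤ) (unique : ∀ {y} → F y ≡ F x₀ → y ≈ x₀) where

      a : Fin r
      a = F x₀

      Φ : ℤ → Fin r
      Φ t = F (x₀ + t)

      centre : ∀ {t} → Φ t ≡ a → t ≈ + 0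
      centre {t} e = ≈-scale (+ 1) (unique e) (lem x₀ t)
        where lem : ∀ x t → t - + 0 ≡ + 1 * (x + t - x)
              lem = solve-∀

      Φ0 : Φ (+ 0) ≡ a
      Φ0 = F-cong (≈-reflexive (ℤ.+-identityʳ x₀))

      Φ-cong : ∀ {s t} → s ≈ t → Φ s ≡ Φ t
      Φ-cong e = F-cong (+-cong (≈-refl {x = x₀}) e)

      Φ-rainbowFree : ∀ x y z → x + z ≈ y + y → ¬ Distinct (Φ x) (Φ y) (Φ z)
      Φ-rainbowFree x y z e = F-rainbowFree (x₀ + x) (x₀ + y) (x₀ + z) (≈-scale (+ 1) e (lem x₀ x y z))
        where lem : ∀ s x y z → s + x + (s + z) - (s + y + (s + y)) ≡ + 1 * (x + z - (y + y))
              lem = solve-∀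

      opaque
        ≉0⇒≢a : ∀ {t} → t ≉ + 0 → Φ t ≢ a
        ≉0⇒≢a t≉0 = t≉0 ∘ centre

      neg≉0 : ∀ {t} → t ≉ + 0 → - t ≉ + 0
      neg≉0 t≉0 e = t≉0 (≈-trans (≈-reflexive (sym (ℤ.neg-involutive _))) (neg-cong e))

      -- In `-t, 0, t` the middle term has a colour used nowhere else, so the outer two must agree.
      -- The progression `0, t, 2t` serves `Φ-double` in the same way.
      Φ-neg : ∀ t → Φ (- t) ≡ Φ t
      Φ-neg t with t ≈? (+ 0)
      ... | yes t≈0 = Φ-cong (≈-trans (neg-cong t≈0) (≈-sym t≈0))
      ... | no  t≉0 = decidable-stable (_ Fin.≟ _) λ ne → Φ-rainbowFree (- t) (+ 0) t (≈-reflexive (ℤ.+-inverseˡ t))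
        ( (λ e → ≉0⇒≢a (neg≉0 t≉0) (trans e Φ0)) , (λ e → ≉0⇒≢a t≉0 (trans (sym e) Φ0)) , ne)

      Φ-double : ∀ t → Φ (t + t) ≡ Φ t
      Φ-double t with t ≈? (+ 0)
      ... | yes t≈0 = Φ-cong (≈-trans (+-cong t≈0 t≈0) (≈-sym t≈0))
      ... | no  t≉0 = decidable-stable (_ Fin.≟ _) λ ne → Φ-rainbowFree (+ 0) t (t + t) (≈-reflexive (ℤ.+-identityˡ (t + t)))
        ( (λ e → ≉0⇒≢a t≉0 (trans (sym e) Φ0)) , (λ e → ne (sym e))
        , (λ e → ≉0⇒≢a (t≉0 ∘ double≈0 t) (trans (sym e) Φ0)))

      Φ-pow : ∀ j t → Φ (pow j * t) ≡ Φ t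
      Φ-pow zero    t = cong Φ (ℤ.*-identityˡ t)
      Φ-pow (suc j) t = trans (cong Φ (trans (cong (_* t) (pow-+ 1 j)) (lem (pow j) t)))
                          (trans (Φ-double (pow j * t)) (Φ-pow j t))
        where lem : ∀ x t → + 2 * x * t ≡ x * t + x * t
              lem = solve-∀

      Φ-orbit : ∀ {s t} → s ~ t → Φ s ≡ Φ t
      Φ-orbit {t = t} (related j (inj₁ e)) = trans (Φ-cong e) (Φ-pow j t)
      Φ-orbit {t = t} (related j (inj₂ e)) = trans (Φ-cong e) (trans (Φ-neg (pow j * t)) (Φ-pow j t))

      -- The singleton class obtained by merging the colours other than Φ s and Φ t
      -- is stable under reflection about x₀, so it is {x₀}.
      noFourth : ∀ {s t u} → Distinct (Φ s) (Φ t) (Φ u) → s ≉ + 0 → t ≉ + 0 → u ≈ + 0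
      noFourth {s} {t} {u} d@(_ , t≢u , s≢u) s≉0 t≉0 = fromSingleton (mergedSingleton (x₀ + s) (x₀ + t) (x₀ + u) d)
        where
        m : Fin r → Colour
        m = merge (Φ s) (Φ t)

        fromSingleton : (∃ λ x → ∀ y → m (F y) ≡ m (F x) → y ≈ x) → u ≈ + 0
        fromSingleton (x , single) = centre (F-cong (≈-trans (single (x₀ + u) same) x≈x₀))
          where
          τ : ℤ
          τ = x - x₀
          there : ∀ x y → x + (y - x) ≡ y
          there = solve-∀
          reflected : x₀ + - τ ≈ x
          reflected = single (x₀ + - τ) (cong m (trans (Φ-neg τ) (cong F (there x₀ x))))
          x≈x₀ : x ≈ x₀
          x≈x₀ = ≈-scale (+ 1) (double≈0 τ (≈-scale (- + 1) reflected (lem x₀ x))) (lem′ x x₀)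
            where
            lem : ∀ x y → y - x + (y - x) - + 0 ≡ - + 1 * (x + - (y - x) - y)
            lem = solve-∀
            lem′ : ∀ x y → x - y ≡ + 1 * (x - y - + 0)
            lem′ = solve-∀
          same : m (Φ u) ≡ m (F x)
          same = trans (merge-rest (s≢u ∘ sym) (t≢u ∘ sym)) (sym
            (trans (cong m (F-cong x≈x₀)) (merge-rest (≉0⇒≢a s≉0 ∘ sym) (≉0⇒≢a t≉0 ∘ sym))))

      values : Fin size → Fin k
      values i = Fin.punchOut (≉0⇒≢a (nz≉0 (rep i)) ∘ sym)

      punchIn-values : ∀ i → Fin.punchIn a (values i) ≡ Φ (nz (rep i))
      punchIn-values i = Fin.punchIn-punchOut _

      values-twoValued : ∀ {s t} → a ≢ Φ s → a ≢ Φ t → Φ s ≢ Φ t → TwoValued values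
      values-twoValued {s} {t} a≢s a≢t s≢t =
        Fin.punchOut a≢s , Fin.punchOut a≢t , s≢t ∘ Fin.punchOut-injective a≢s a≢t , cover , attained a≢s , attained a≢t
        where
        away : ∀ {t} → a ≢ Φ t → t ≉ + 0
        away a≢t e = a≢t (sym (trans (Φ-cong e) Φ0))
        cover : ∀ i → values i ≡ Fin.punchOut a≢s ⊎ values i ≡ Fin.punchOut a≢t
        cover i with Φ (nz (rep i)) Fin.≟ Φ s | Φ (nz (rep i)) Fin.≟ Φ t
        ... | yes e | _     = inj₁ (Fin.punchOut-cong a e)
        ... | no _  | yes e = inj₂ (Fin.punchOut-cong a e)
        ... | no ≢s | no ≢t = contradiction
          (noFourth (s≢t , ≢t ∘ sym , ≢s ∘ sym) (away a≢s) (away a≢t)) (nz≉0 (rep i))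
        attained : ∀ {t} (a≢t : a ≢ Φ t) → ∃ λ i → values i ≡ Fin.punchOut a≢t
        attained {t} a≢t with j , j≈t ← nonzero (away a≢t) =
          class j , Fin.punchOut-cong a (trans (sym (Φ-orbit (rep-class j))) (Φ-cong j≈t))

  module Two = Enumerates (twoValued size k)

  -- The centre, its colour, and the colouring of the orbits by the remaining colours.
  Index : Set
  Index = Fin p × Fin r × TwoValuedIndex size k

  shift unshift : Fin p → Fin p → Fin p
  shift   x₀ x = residue (⟦ x ⟧ - ⟦ x₀ ⟧)
  unshift x₀ x = residue (⟦ x₀ ⟧ + ⟦ x ⟧)

  shift-unshift : ∀ x₀ x → shift x₀ (unshift x₀ x) ≡ x
  shift-unshift x₀ x = trans
    (residue-cong (≈-scale (+ 1) (⟦residue⟧ (⟦ x₀ ⟧ + ⟦ x ⟧)) (lem ⟦ unshift x₀ x ⟧ ⟦ x₀ ⟧ ⟦ x ⟧)))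
    (residue-⟦⟧ x)
    where lem : ∀ z y x → z - y - x ≡ + 1 * (z - (y + x))
          lem = solve-∀

  shift-zero : ∀ {x₀ x} → shift x₀ x ≡ zero → x ≡ x₀
  shift-zero {x₀} {x} e = ⟦⟧-injective (≈-scale (- + 1)
    (≈-trans (≈-reflexive (cong ⟦_⟧ (sym e))) (⟦residue⟧ (⟦ x ⟧ - ⟦ x₀ ⟧))) (lem ⟦ x ⟧ ⟦ x₀ ⟧))
    where lem : ∀ x y → x - y ≡ - + 1 * (+ 0 - (x - y))
          lem = solve-∀

  shift-self : ∀ x₀ → shift x₀ x₀ ≡ zero
  shift-self x₀ = trans (residue-cong (≈-reflexive (ℤ.+-inverseʳ ⟦ x₀ ⟧))) (residue-⟦⟧ zero)

  paint : Fin r → (Fin size → Fin k) → Fin p → Fin r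
  paint a v zero    = a
  paint a v (suc i) = Fin.punchIn a (v (class i))

  -- If exactly one term is 0, one of the others is the negative or the double of the remaining one,
  -- so they share an orbit. Away from 0 only two colours occur.
  paint-rainbowFree : ∀ a {v} → TwoValued v → ∀ x y z → ⟦ x ⟧ + ⟦ z ⟧ ≈ ⟦ y ⟧ + ⟦ y ⟧ →
                      ¬ Distinct (paint a v x) (paint a v y) (paint a v z)
  paint-rainbowFree a tv zero    zero    z       e (x≢y , _   , _  ) = x≢y refl
  paint-rainbowFree a tv zero    (suc j) zero    e (_   , _   , x≢z) = x≢z refl
  paint-rainbowFree a tv (suc i) zero    zero    e (_   , y≢z , _  ) = y≢z refl
  paint-rainbowFree a {v} tv zero (suc j) (suc l) e (_ , y≢z , _) = y≢z (cong (Fin.punchIn a ∘ v) (sym (class-cong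
    (~-trans (≈⇒~ (≈-trans (≈-reflexive (sym (ℤ.+-identityˡ (nz l)))) e)) (double~ (nz j))))))
  paint-rainbowFree a {v} tv (suc i) zero (suc l) e (_ , _ , x≢z) = x≢z (cong (Fin.punchIn a ∘ v) (class-cong
    (~-trans (≈⇒~ (≈-scale (+ 1) e (lem (nz i) (nz l)))) (neg~ (nz l)))))
    where lem : ∀ x z → x - - z ≡ + 1 * (x + z - + 0)
          lem = solve-∀
  paint-rainbowFree a {v} tv (suc i) (suc j) zero e (x≢y , _ , _) = x≢y (cong (Fin.punchIn a ∘ v) (class-cong
    (~-trans (≈⇒~ (≈-trans (≈-reflexive (sym (ℤ.+-identityʳ (nz i)))) e)) (double~ (nz j)))))
  paint-rainbowFree a tv (suc i) (suc j) (suc l) e (x≢y , y≢z , x≢z) =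
    twoValued-noThree tv (class i) (class j) (class l)
      (x≢y ∘ cong (Fin.punchIn a) , y≢z ∘ cong (Fin.punchIn a) , x≢z ∘ cong (Fin.punchIn a))

  paint-injective : ∀ {a v} → ∀ x → paint a v x ≡ a → x ≡ zero
  paint-injective         zero    _ = refl
  paint-injective {a} {v} (suc i) e = contradiction e (Fin.punchInᵢ≢i a (v (class i)))

  enum : Index → Coloring r p
  enum (x₀ , a , w) x = paint a (Two.enum w) (shift x₀ x)

  enum-unshift : ∀ x₀ a w y → enum (x₀ , a , w) (unshift x₀ y) ≡ paint a (Two.enum w) y
  enum-unshift x₀ a w y = cong (paint a (Two.enum w)) (shift-unshift x₀ y)

  enum-centre : ∀ x₀ a w → enum (x₀ , a , w) x₀ ≡ a
  enum-centre x₀ a w = cong (paint a (Two.enum w)) (shift-self x₀)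

  enum-unique : ∀ x₀ a w {x} → enum (x₀ , a , w) x ≡ a → x ≡ x₀
  enum-unique x₀ a w = shift-zero ∘ paint-injective _

  enum-rainbowFree : ∀ i → RainbowFree (enum i)
  enum-rainbowFree (x₀ , a , w) x y z ap = paint-rainbowFree a (Two.sound w) (shift x₀ x) (shift x₀ y) (shift x₀ z)
    (≈-trans (+-cong (⟦residue⟧ _) (⟦residue⟧ _)) (≈-trans
      (≈-scale (+ 1) (AP₃⇒≈ x y z ap) (lem ⟦ x ⟧ ⟦ y ⟧ ⟦ z ⟧ ⟦ x₀ ⟧))
      (≈-sym (+-cong (⟦residue⟧ _) (⟦residue⟧ _)))))
    where lem : ∀ x y z s → x - s + (z - s) - (y - s + (y - s)) ≡ + 1 * (x + z - (y + y))
          lem = solve-∀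

  enum-threeColoured : ∀ i → ThreeColoured (enum i)
  enum-threeColoured (x₀ , a , w) with b , d , b≢d , _ , (i , vi≡b) , (j , vj≡d) ← Two.sound w =
    unshift x₀ zero , unshift x₀ (suc (rep i)) , unshift x₀ (suc (rep j)) ,
    subst (λ ((x , y) , z) → Distinct x y z) (sym (cong₂ _,_ (cong₂ _,_
        (enum-unshift x₀ a w zero) (trans (enum-unshift x₀ a w _) (at i vi≡b))) (trans (enum-unshift x₀ a w _) (at j vj≡d))))
      (Fin.punchInᵢ≢i a b ∘ sym , b≢d ∘ Fin.punchIn-injective a b d , Fin.punchInᵢ≢i a d ∘ sym)
    where
    at : ∀ i {b} → Two.enum w i ≡ b → Fin.punchIn a (Two.enum w (class (rep i))) ≡ Fin.punchIn a b
    at i e = cong (Fin.punchIn a) (trans (cong (Two.enum w) (class-rep i)) e)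

  -- The centre is the only point of its colour, but the colour of any other
  -- point is shared by its reflection about the centre.
  centre-injective : ∀ x₀ a w x₀′ a′ w′ → enum (x₀ , a , w) ≗ enum (x₀′ , a′ , w′) → x₀ ≡ x₀′
  centre-injective x₀ a w x₀′ a′ w′ e = compare (shift x₀′ x₀) refl
    where
    compare : ∀ y → shift x₀′ x₀ ≡ y → x₀ ≡ x₀′
    compare zero    shift≡ = shift-zero shift≡
    compare (suc j) shift≡ = contradiction (double≈0 (nz j) 2j≈0) (nz≉0 j)
      where
      -j : ∃ λ i → nz i ≈ - nz j
      -j = nonzero λ -j≈0 → nz≉0 j (≈-trans (≈-reflexive (sym (ℤ.neg-involutive _))) (neg-cong -j≈0))
      mirror : Fin p
      mirror = unshift x₀′ (suc (proj₁ -j))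
      colour : enum (x₀ , a , w) mirror ≡ a
      colour = begin
        enum (x₀ , a , w) mirror                                  ≡⟨ e mirror ⟩
        enum (x₀′ , a′ , w′) mirror                               ≡⟨ enum-unshift x₀′ a′ w′ (suc (proj₁ -j)) ⟩
        Fin.punchIn a′ (Two.enum w′ (class (proj₁ -j)))           ≡⟨ cong (Fin.punchIn a′ ∘ Two.enum w′)
                                                                      (class-cong (~-trans (≈⇒~ (proj₂ -j)) (neg~ (nz j)))) ⟩
        Fin.punchIn a′ (Two.enum w′ (class j))                    ≡⟨ cong (paint a′ (Two.enum w′)) shift≡ ⟨
        enum (x₀′ , a′ , w′) x₀                                   ≡⟨ e x₀ ⟨
        enum (x₀ , a , w) x₀                                      ≡⟨ enum-centre x₀ a w ⟩
        a                                                         ∎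
        where open ≡-Reasoning
      x₀-x₀′ : ⟦ x₀ ⟧ - ⟦ x₀′ ⟧ ≈ nz j
      x₀-x₀′ = ≈-trans (≈-sym (⟦residue⟧ _)) (≈-reflexive (cong ⟦_⟧ shift≡))
      x₀≈ : ⟦ x₀ ⟧ ≈ ⟦ x₀′ ⟧ + - nz j
      x₀≈ = ≈-trans (≈-reflexive (cong ⟦_⟧ (sym (enum-unique x₀ a w colour))))
              (≈-trans (⟦residue⟧ _) (+-cong (≈-refl {x = ⟦ x₀′ ⟧}) (proj₂ -j)))
      2j≈0 : nz j + nz j ≈ + 0
      2j≈0 = ≈-combine (- + 1) (+ 1) x₀-x₀′ x₀≈ (lem ⟦ x₀ ⟧ ⟦ x₀′ ⟧ (nz j))
        where lem : ∀ x y j → j + j - + 0 ≡ - + 1 * (x - y - j) + + 1 * (x - (y + - j))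
              lem = solve-∀

  enum-injective : ∀ {i j} → enum i ≗ enum j → i ≡ j
  enum-injective {x₀ , a , w} {x₀′ , a′ , w′} e with refl ← centre-injective x₀ a w x₀′ a′ w′ e
    with refl ← trans (sym (enum-centre x₀ a w)) (trans (e x₀) (enum-centre x₀ a′ w′)) =
    cong (λ z → x₀ , a , z) (Two.injective λ i → trans (sym (cong (Two.enum w) (class-rep i))) (trans
      (Fin.punchIn-injective a _ _ (trans (sym (enum-unshift x₀ a w (suc (rep i))))
        (trans (e _) (enum-unshift x₀ a w′ (suc (rep i))))))
      (cong (Two.enum w′) (class-rep i))))

  enum-complete : ∀ {f} → RainbowFree f → ThreeColoured f → ∃ λ i → enum i ≗ f
  enum-complete {f} rf (u , v , w , d) = fromSingleton (mergedSingleton ⟦ u ⟧ ⟦ v ⟧ ⟦ w ⟧ d′)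
    where
    open Structure f rf
    F⟦⟧ : ∀ x → F ⟦ x ⟧ ≡ f x
    F⟦⟧ x = cong f (residue-⟦⟧ x)
    d′ : Distinct (F ⟦ u ⟧) (F ⟦ v ⟧) (F ⟦ w ⟧)
    d′ = subst (λ ((x , y) , z) → Distinct x y z) (sym (cong₂ _,_ (cong₂ _,_ (F⟦⟧ u) (F⟦⟧ v)) (F⟦⟧ w))) d

    fromSingleton : (∃ λ x → ∀ y → merge (F ⟦ u ⟧) (F ⟦ v ⟧) (F y) ≡ merge (F ⟦ u ⟧) (F ⟦ v ⟧) (F x) → y ≈ x) →
                    ∃ λ i → enum i ≗ f
    fromSingleton (x , single) = fromTwo (two (twoOthers d′ a))
      where
      unique : ∀ {y} → F y ≡ F x → y ≈ x
      unique {y} e = single y (cong (merge (F ⟦ u ⟧) (F ⟦ v ⟧)) e)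
      open Centred x unique
      there : ∀ x y → x + (y - x) ≡ y
      there = solve-∀
      pair : ∀ s t → a ≢ F ⟦ s ⟧ → a ≢ F ⟦ t ⟧ → F ⟦ s ⟧ ≢ F ⟦ t ⟧ → TwoValued values
      pair s t a≢s a≢t s≢t = values-twoValued {⟦ s ⟧ - x} {⟦ t ⟧ - x}
        (λ e → a≢s (trans e (Φs s))) (λ e → a≢t (trans e (Φs t)))
        (λ e → s≢t (trans (sym (Φs s)) (trans e (Φs t))))
        where
        Φs : ∀ s → Φ (⟦ s ⟧ - x) ≡ F ⟦ s ⟧
        Φs s = cong F (there x ⟦ s ⟧)
      -- The centre shares its colour with at most one of `u`, `v`, `w`, which leaves two points to
      -- supply the noncentral colours.
      two : (a ≢ F ⟦ u ⟧ × a ≢ F ⟦ v ⟧) ⊎ (a ≢ F ⟦ u ⟧ × a ≢ F ⟦ w ⟧) ⊎ (a ≢ F ⟦ v ⟧ × a ≢ F ⟦ w ⟧) →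
            TwoValued values
      two (inj₁ (a≢u , a≢v))        = pair u v a≢u a≢v (proj₁ d′)
      two (inj₂ (inj₁ (a≢u , a≢w))) = pair u w a≢u a≢w (proj₂ (proj₂ d′))
      two (inj₂ (inj₂ (a≢v , a≢w))) = pair v w a≢v a≢w (proj₁ (proj₂ d′))
      fromTwo : TwoValued values → ∃ λ i → enum i ≗ f
      fromTwo tv with i , agree ← Two.complete tv = (residue x , a , i) , λ y →
        trans (paint-Φ (shift (residue x) y)) (trans (Φ-cong (shifted y)) (trans (cong F (there x ⟦ y ⟧)) (F⟦⟧ y)))
        where
        paint-Φ : ∀ y → paint a (Two.enum i) y ≡ Φ ⟦ y ⟧
        paint-Φ zero    = sym Φ0
        paint-Φ (suc j) = trans (cong (Fin.punchIn a) (agree (class j)))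
          (trans (punchIn-values (class j)) (sym (Φ-orbit (rep-class j))))
        shifted : ∀ y → ⟦ shift (residue x) y ⟧ ≈ ⟦ y ⟧ - x
        shifted y = ≈-trans (⟦residue⟧ _) (+-cong (≈-refl {x = ⟦ y ⟧}) (neg-cong (⟦residue⟧ x)))

  threeColoured : Enumerates Index (λ f → RainbowFree f × ThreeColoured f)
  threeColoured = record
    { enum = enum ; injective = enum-injective
    ; sound = λ i → enum-rainbowFree i , enum-threeColoured i
    ; complete = λ (rf , tc) → enum-complete rf tc }

-- Classification of rainbow-free colourings and the final count

rainbowFree-resp : ∀ {r p} {f f′ : Coloring r p} → f ≗ f′ → RainbowFree f → RainbowFree f′
rainbowFree-resp e rf x y z ap (x≢y , y≢z , x≢z) = rf x y z ap
  ( (λ h → x≢y (trans (sym (e x)) (trans h (e y))))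
  , (λ h → y≢z (trans (sym (e y)) (trans h (e z))))
  , (λ h → x≢z (trans (sym (e x)) (trans h (e z)))))

module _ {r n : ℕ} where

  private
    Class : Coloring r (suc n) → Set
    Class f = Constant f ⊎ TwoValued f ⊎ (RainbowFree f × ThreeColoured f)

  class⇒rainbowFree : ∀ {f} → Class f → RainbowFree f
  class⇒rainbowFree (inj₁ const)           x y z _ (x≢y , _) = x≢y (const x y)
  class⇒rainbowFree (inj₂ (inj₁ tv))       x y z _           = twoValued-noThree tv x y z
  class⇒rainbowFree (inj₂ (inj₂ (rf , _)))                   = rf

  rainbowFree⇒class : ∀ {f} → RainbowFree f → Class f
  rainbowFree⇒class {f} rf with Fin.any? (λ x → ¬? (f zero Fin.≟ f x))
  ... | no none = inj₁ λ x y → trans (sym (stable x)) (stable y)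
    where
    stable : ∀ x → f zero ≡ f x
    stable x = decidable-stable (f zero Fin.≟ f x) λ ne → none (x , ne)
  ... | yes (x , 0≢x) with Fin.any? (λ y → ¬? (f y Fin.≟ f zero) ×-dec ¬? (f y Fin.≟ f x))
  ...   | yes (y , y≢0 , y≢x) = inj₂ (inj₂ (rf , zero , x , y , 0≢x , y≢x ∘ sym , y≢0 ∘ sym))
  ...   | no none = inj₂ (inj₁ (f zero , f x , 0≢x , cover , (zero , refl) , (x , refl)))
    where
    cover : ∀ y → f y ≡ f zero ⊎ f y ≡ f x
    cover y = decidable-stable ((f y Fin.≟ f zero) ⊎-dec (f y Fin.≟ f x)) λ ne →
      none (y , ne ∘ inj₁ , ne ∘ inj₂)

constant-disjoint : ∀ {r n} {f f′ : Coloring r n} → f ≗ f′ → Constant f →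
                    ¬ (TwoValued f′ ⊎ (RainbowFree f′ × ThreeColoured f′))
constant-disjoint e const (inj₁ (b , c , b≢c , _ , (x , x≡b) , (y , y≡c))) =
  b≢c (trans (sym x≡b) (trans (sym (e x)) (trans (const x y) (trans (e y) y≡c))))
constant-disjoint e const (inj₂ (_ , x , y , _ , x≢y , _)) = x≢y (trans (sym (e x)) (trans (const x y) (e y)))

twoValued-disjoint : ∀ {r n} {f f′ : Coloring r n} → f ≗ f′ → TwoValued f → ¬ (RainbowFree f′ × ThreeColoured f′)
twoValued-disjoint e tv (_ , x , y , z , d) = twoValued-noThree tv x y z
  (subst (λ ((x , y) , z) → Distinct x y z) (sym (cong₂ _,_ (cong₂ _,_ (e x) (e y)) (e z))) d)

nC2 : ∀ n → 2 ℕ.* (suc n C 2) ≡ suc n ℕ.* n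
nC2 zero    = refl
nC2 (suc n) = begin
  2 ℕ.* (suc (suc n) C 2)               ≡⟨ cong (2 ℕ.*_) (nCk+nC[k+1]≡[n+1]C[k+1] (suc n) 1) ⟨
  2 ℕ.* (suc n C 1 ℕ.+ suc n C 2)       ≡⟨ cong (λ t → 2 ℕ.* (t ℕ.+ suc n C 2)) (nC1≡n (suc n)) ⟩
  2 ℕ.* (suc n ℕ.+ suc n C 2)           ≡⟨ ℕ.*-distribˡ-+ 2 (suc n) (suc n C 2) ⟩
  2 ℕ.* suc n ℕ.+ 2 ℕ.* (suc n C 2)     ≡⟨ cong (2 ℕ.* suc n ℕ.+_) (trans (nC2 n) (ℕ.*-comm (suc n) n)) ⟩
  2 ℕ.* suc n ℕ.+ n ℕ.* suc n           ≡⟨ ℕ.*-distribʳ-+ (suc n) 2 n ⟨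
  suc (suc n) ℕ.* suc n                 ∎
  where open ≡-Reasoning

-- Bracketed like the index types, so that `classSizes-↔` follows it factor by factor; `m` is the
-- number of orbits.
classSizes : ℕ → ℕ → ℕ → ℕ
classSizes r p m = r ℕ.+ (r ℕ.* ((r ∸ 1) ℕ.* (2 ^ (p ∸ 1) ∸ 1)) ℕ.+
  p ℕ.* (r ℕ.* ((r ∸ 1) ℕ.* ((r ∸ 1 ∸ 1) ℕ.* (2 ^ (m ∸ 1) ∸ 1)))))

classSizes-↔ : ∀ r p m → (Fin r ⊎ TwoValuedIndex p r ⊎ (Fin p × Fin r × TwoValuedIndex m (r ∸ 1))) ↔ Fin (classSizes r p m)
classSizes-↔ r p m = ↔-sym (
  (↔-id _ ⊎-↔ ((twos r p ⊎-↔ ((↔-id _ ×-↔ ((↔-id _ ×-↔ twos (r ∸ 1) m) ↔-∘ Fin.*↔×)) ↔-∘ Fin.*↔×)) ↔-∘ Fin.+↔⊎)) ↔-∘ Fin.+↔⊎)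
  where
  twos : ∀ k n → Fin (k ℕ.* ((k ∸ 1) ℕ.* (2 ^ (n ∸ 1) ∸ 1))) ↔ TwoValuedIndex n k
  twos k n = (↔-id _ ×-↔ Fin.*↔×) ↔-∘ Fin.*↔×

-- The part `r - r(r-1)` gives `-r^2 + 2r`. Writing `(r-1)(r-2)` as twice a binomial coefficient
-- doubles `2^m - 1` to `2^(m+1) - 2`, where `m + 1` is the number of orbits.
classSizes-formula : ∀ k q m → let r = suc (suc k); p = suc q in
  + classSizes r p (suc m) ≡ + (r C 2) * + (2 ^ p) - + (r ^ 2) + + 2 * + r
                             + + r * + ((r ∸ 1) C 2) * + p * (+ (2 ^ suc m) - + 2)
classSizes-formula k q m = begin
  + r + (+ (r ℕ.* (suc k ℕ.* a)) + + (p ℕ.* (r ℕ.* (suc k ℕ.* (k ℕ.* b)))))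
    ≡⟨ cong (λ t → + r + t) (cong₂ _+_ (pos-*² r (suc k) a)
         (trans (pos-*² p r (suc k ℕ.* (k ℕ.* b))) (cong (λ t → + p * (+ r * t)) (pos-*² (suc k) k b)))) ⟩
  + r + (+ r * (+ suc k * + a) + + p * (+ r * (+ suc k * (+ k * + b))))
    ≡⟨ expand (+ k) (+ p) (+ a) (+ b) ⟩
  (+ 2 + + k) * (+ 1 + + k) * (+ 1 + + a) - + r * + r + + 2 * + r + + r * ((+ 1 + + k) * + k) * + p * + b
    ≡⟨ cong₂ (λ s t → s * (+ 1 + + a) - + r * + r + + 2 * + r + + r * t * + p * + b) (twice (suc k)) (twice k) ⟨
  + 2 * + (r C 2) * (+ 1 + + a) - + r * + r + + 2 * + r + + r * (+ 2 * + (suc k C 2)) * + p * + b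
    ≡⟨ factor (+ (r C 2)) (+ (suc k C 2)) (+ r) (+ p) (+ a) (+ b) ⟩
  + (r C 2) * (+ 2 * (+ 1 + + a)) - + r * + r + + 2 * + r + + r * + (suc k C 2) * + p * (+ 2 * (+ 1 + + b) - + 2)
    ≡⟨ cong₂ (λ s t → s - t + + 2 * + r + + r * + (suc k C 2) * + p * (+ 2 * (+ 1 + + b) - + 2))
         (cong (λ t → + (r C 2) * t) (power q)) square ⟨
  + (r C 2) * + (2 ^ p) - + (r ^ 2) + + 2 * + r + + r * + (suc k C 2) * + p * (+ 2 * (+ 1 + + b) - + 2)
    ≡⟨ cong (λ t → + (r C 2) * + (2 ^ p) - + (r ^ 2) + + 2 * + r + + r * + (suc k C 2) * + p * (t - + 2)) (power m) ⟨
  + (r C 2) * + (2 ^ p) - + (r ^ 2) + + 2 * + r + + r * + (suc k C 2) * + p * (+ (2 ^ suc m) - + 2) ∎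
  where
  open ≡-Reasoning
  r p a b : ℕ
  r = suc (suc k)
  p = suc q
  a = 2 ^ q ∸ 1
  b = 2 ^ m ∸ 1

  pos-*² : ∀ x y z → + (x ℕ.* (y ℕ.* z)) ≡ + x * (+ y * + z)
  pos-*² x y z = trans (ℤ.pos-* x (y ℕ.* z)) (cong (λ t → + x * t) (ℤ.pos-* y z))

  twice : ∀ j → + 2 * + (suc j C 2) ≡ + suc j * + j
  twice j = trans (sym (ℤ.pos-* 2 (suc j C 2))) (trans (cong +_ (nC2 j)) (ℤ.pos-* (suc j) j))

  power : ∀ j → + (2 ^ suc j) ≡ + 2 * (+ 1 + + (2 ^ j ∸ 1))
  power j = trans (ℤ.pos-* 2 (2 ^ j)) (cong (λ t → + 2 * + t) (sym (ℕ.m+[n∸m]≡n (ℕ.m^n>0 2 j))))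

  square : + (r ^ 2) ≡ + r * + r
  square = trans (cong (λ t → + (r ℕ.* t)) (ℕ.*-identityʳ r)) (ℤ.pos-* r r)

  expand : ∀ k p a b → + 2 + k + ((+ 2 + k) * ((+ 1 + k) * a) + p * ((+ 2 + k) * ((+ 1 + k) * (k * b)))) ≡
    (+ 2 + k) * (+ 1 + k) * (+ 1 + a) - (+ 2 + k) * (+ 2 + k) + + 2 * (+ 2 + k) +
      (+ 2 + k) * ((+ 1 + k) * k) * p * b
  expand = solve-∀

  factor : ∀ t u r p a b → + 2 * t * (+ 1 + a) - r * r + + 2 * r + r * (+ 2 * u) * p * b ≡
    t * (+ 2 * (+ 1 + a)) - r * r + + 2 * r + r * u * p * (+ 2 * (+ 1 + b) - + 2)
  factor = solve-∀

theorem1p6 : ∀ p → Prime p → 3 ≤ p → ∀ r → 3 ≤ r →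
    + g r p ≡ + (r C 2) * + (2 ^ p) - + (r ^ 2) + + 2 * + r
    + + r * + ((r ∸ 1) C 2) * + p * (+ (2 ^ (((p ∸ 1) / (c p ℕ.* ord p 2)) {{c*ord-nonZero p}})) - + 2)
theorem1p6 (suc (suc _)) _ _ (suc zero) (s≤s ())
theorem1p6 p@(suc q@(suc _)) pr 3≤p r@(suc (suc k)) 3≤r = begin
  + g r p                     ≡⟨ cong +_ (filter-length rainbowFree? rainbowFree-resp enumeration (classSizes-↔ r p size)) ⟩
  + classSizes r p size       ≡⟨ cong (λ m → + classSizes r p m) (ℕ.suc-pred size) ⟨
  + classSizes r p (suc (ℕ.pred size))  ≡⟨ classSizes-formula k q (ℕ.pred size) ⟩
  formula (suc (ℕ.pred size)) ≡⟨ cong formula (trans (ℕ.suc-pred size) (sym quotient≡)) ⟩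
  formula (((p ∸ 1) / (c p ℕ.* ord p 2)) {{c*ord-nonZero p}}) ∎
  where
  open ≡-Reasoning

  isOrder : IsOrder p 2 (ord p 2)
  isOrder = ord-isOrder p 2 (Coprime.sym (prime⇒coprime pr 3≤p))

  open Orbits q pr 3≤p (ord p 2) isOrder using (SignedPowers; signedPowers)

  powers : SignedPowers (c p ℕ.* ord p 2)
  powers = signedPowers (2 ℕ.∣? ord p 2)

  open OrbitClasses q pr 3≤p (ord p 2) isOrder powers using (size; class; orbit-count)
  open ThreeColouredCount q pr 3≤p (ord p 2) isOrder powers (suc k) using (threeColoured)

  instance
    -- As `q` is positive, 1 is a nonzero residue and lies in some orbit; this justifies the
    -- successor in `classSizes-formula`.
    size-nonZero : NonZero size
    size-nonZero = Fin.nonZeroIndex (class zero)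

  quotient≡ : ((p ∸ 1) / (c p ℕ.* ord p 2)) {{c*ord-nonZero p}} ≡ size
  quotient≡ = trans (cong (λ t → (t / (c p ℕ.* ord p 2)) {{c*ord-nonZero p}}) (sym orbit-count))
                    (ℕ.m*n/n≡m size (c p ℕ.* ord p 2) {{c*ord-nonZero p}})

  enumeration : Enumerates _ RainbowFree
  enumeration = enumerates-⇔
    (enumerates-⊎ constants (enumerates-⊎ (twoValued p r) threeColoured twoValued-disjoint) constant-disjoint)
    class⇒rainbowFree rainbowFree⇒class

  formula : ℕ → _
  formula m = + (r C 2) * + (2 ^ p) - + (r ^ 2) + + 2 * + r + + r * + ((r ∸ 1) C 2) * + p * (+ (2 ^ m) - + 2)
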